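{- Let $q$ be a prime power and let $L$ be a line of $\mathrm{PG}(5,q)$ in the $K$-orbit $o_{10}$. Then the hyperplane-orbit distribution of $L$ is $OD_4(L)=[1,\,q^2+q,\,q^2,\,q^3-q^2]$.
   Context: A point $(y_0,\dots,y_5)$ of $\mathrm{PG}(5,q)$ is identified with the nonzero symmetric matrix $\begin{bmatrix} y_0&y_1&y_2\\ y_1&y_3&y_4\\ y_2&y_4&y_5\end{bmatrix}$ up to scalar. $K\cong\mathrm{PGL}(3,q)$ acts by $M\mapsto AMA^T$, $A\in\mathrm{GL}(3,q)$. The orbit $o_{10}$ is the $K$-orbit of the line $\left\{\begin{bmatrix} v_0x&y&0\\ y&x+uy&0\\ 0&0&0\end{bmatrix}:(x,y)\in\mathrm{PG}(1,q)\right\}$, where $u,v_0\in\mathbb F_q$, $v_0\ne0$, satisfy $v_0\lambda^2+uv_0\lambda-1\neq0$ for all $\lambda\in\mathbb F_q$ (the orbit does not depend on the choice of such $u,v_0$). Hyperplanes correspond to conics of $\mathrm{PG}(2,q)$ (nonzero quadratic forms up to scalar): $\sum_{0\le i\le j\le2}a_{ij}X_iX_j$ corresponds to $a_{00}Y_0+a_{01}Y_1+a_{02}Y_2+a_{11}Y_3+a_{12}Y_4+a_{22}Y_5=0$. $\mathcal H_1,\mathcal H_{2,r},\mathcal H_{2,i},\mathcal H_3$ are the sets of hyperplanes corresponding respectively to double lines (scalar multiples of squares of linear forms), pairs of distinct real lines (products of two non-proportional linear forms over $\mathbb F_q$), pairs of conjugate imaginary lines (scalar multiples of products of two non-proportional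 linear forms conjugate over $\mathbb F_{q^2}$), and non-singular conics (those with $4a_{00}a_{11}a_{22}+a_{01}a_{02}a_{12}-a_{00}a_{12}^2-a_{11}a_{02}^2-a_{22}a_{01}^2\ne0$). $OD_4(L)=[h_1,h_{2,r},h_{2,i},h_3]$ lists the numbers of hyperplanes in $\mathcal H_1,\mathcal H_{2,r},\mathcal H_{2,i},\mathcal H_3$ containing $L$. -}

module Defs where

open import Level using (Level; _⊔_) renaming (suc to lsuc)
open import Algebra.Bundles using (CommutativeRing; Ring; Semiring)
open import Algebra.Morphism.Structures using (module RingMorphisms)
import Algebra.Definitions.RawSemiring as RawSemiringDefs
open import Data.Fin.Base using (Fin)
open import Data.Fin.Patterns using (0F; 1F; 2F; 3F; 4F; 5F)
open import Data.Fin.Properties using (_≟_)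
open import Data.Bool.Base using (if_then_else_)
open import Data.Nat.Base as ℕ using (ℕ)
open import Data.Nat.Primality using (Prime)
open import Data.Product.Base using (Σ; ∃; ∃-syntax; _×_; _,_; proj₁)
open import Data.Vec.Functional using (Vector; []; _∷_)
open import Function.Bundles using (Inverse)
open import Relation.Binary.Bundles using (Setoid)
import Relation.Binary.Construct.On as On
open import Relation.Binary.PropositionalEquality as ≡ using (_≡_)
import Relation.Binary.Reasoning.Setoid as SetoidReasoning
open import Relation.Nullary using (¬_; does)
open import Relation.Unary using (Pred; _≐_)

IsPrimePower : ℕ → Set
IsPrimePower q = ∃[ p ] ∃[ h ] Prime p × 1 ℕ.≤ h × q ≡ p ℕ.^ h

HasSize : ∀ {a ℓ} → Setoid a ℓ → ℕ → Set (a ⊔ ℓ)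
HasSize S n = Inverse (≡.setoid (Fin n)) S

record FiniteField (q : ℕ) (c ℓ : Level) : Set (lsuc (c ⊔ ℓ)) where
  field
    commutativeRing : CommutativeRing c ℓ
  open CommutativeRing commutativeRing public
  open RawSemiringDefs (Semiring.rawSemiring semiring) public
    using (sum; _^_) renaming (_×_ to _×ℕ_)
  field
    1≉0     : ¬ (1# ≈ 0#)
    inverse : ∀ x → ¬ (x ≈ 0#) → ∃[ y ] x * y ≈ 1#
    size    : HasSize setoid q

-- The field 𝔽_{q²} as an extension of 𝔽_q; ι is injective since F is a field
-- and 1 ≉ 0 in E.
record QuadraticExtension {q c ℓ} (F : FiniteField q c ℓ) (c′ ℓ′ : Level)
       : Set (c ⊔ ℓ ⊔ lsuc (c′ ⊔ ℓ′)) where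
  field
    E : FiniteField (q ℕ.^ 2) c′ ℓ′
  private
    module F = FiniteField F
    module E = FiniteField E
  open RingMorphisms (Ring.rawRing F.ring) (Ring.rawRing E.ring) using (IsRingHomomorphism)
  field
    ι                  : F.Carrier → E.Carrier
    isRingHomomorphism : IsRingHomomorphism ι

  conj : E.Carrier → E.Carrier
  conj x = x E.^ q

module Projective {q c ℓ} (F : FiniteField q c ℓ) where
  open FiniteField F

  NonZero : ∀ {n} → Vector Carrier n → Set ℓ
  NonZero v = ¬ (∀ i → v i ≈ 0#)

  infix 4 _∼_

  _∼_ : ∀ {n} → Vector Carrier n → Vector Carrier n → Set (c ⊔ ℓ)
  v ∼ w = ∃[ k ] ¬ (k ≈ 0#) × (∀ i → v i ≈ k * w i)

  ∼-refl : ∀ {n} {v : Vector Carrier n} → v ∼ v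
  ∼-refl = 1# , 1≉0 , λ i → sym (*-identityˡ _)

  private
    cancel : ∀ {k m} → k * m ≈ 1# → ∀ {x} → m * (k * x) ≈ x
    cancel {k} {m} km≈1 {x} = begin
      m * (k * x)  ≈⟨ *-assoc m k x ⟨
      (m * k) * x  ≈⟨ *-congʳ (*-comm m k) ⟩
      (k * m) * x  ≈⟨ *-congʳ km≈1 ⟩
      1# * x       ≈⟨ *-identityˡ x ⟩
      x            ∎
      where open SetoidReasoning setoid

  ∼-sym : ∀ {n} {v w : Vector Carrier n} → v ∼ w → w ∼ v
  ∼-sym (k , k≉0 , eq) with inverse k k≉0
  ... | m , km≈1 =
    m
    , (λ m≈0 → 1≉0 (trans (sym km≈1) (trans (*-congˡ m≈0) (zeroʳ k))))
    , λ i → sym (trans (*-congˡ (eq i)) (cancel km≈1))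

  ∼-trans : ∀ {n} {u v w : Vector Carrier n} → u ∼ v → v ∼ w → u ∼ w
  ∼-trans (k , k≉0 , eq) (m , m≉0 , eq′) =
    k * m
    , (λ km≈0 → m≉0 (m≈0 km≈0))
    , λ i → trans (eq i) (trans (*-congˡ (eq′ i)) (sym (*-assoc k m _)))
    where
    m≈0 : k * m ≈ 0# → m ≈ 0#
    m≈0 km≈0 with inverse k k≉0
    ... | l , kl≈1 = trans (sym (cancel kl≈1)) (trans (*-congˡ km≈0) (zeroʳ l))

  Point : ℕ → Set (c ⊔ ℓ)
  Point d = Σ (Vector Carrier (ℕ.suc d)) NonZero

  coords : ∀ {d} → Point d → Vector Carrier (ℕ.suc d)
  coords = proj₁

  PG : ℕ → Setoid (c ⊔ ℓ) (c ⊔ ℓ)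
  PG d = record
    { Carrier       = Point d
    ; _≈_           = λ P Q → coords P ∼ coords Q
    ; isEquivalence = record { refl = ∼-refl ; sym = ∼-sym ; trans = ∼-trans }
    }

  record Line (d : ℕ) : Set (c ⊔ ℓ) where
    field
      P Q      : Point d
      distinct : ¬ (coords P ∼ coords Q)

  points : ∀ {d} → Line d → Pred (Point d) (c ⊔ ℓ)
  points L R = ∃[ x ] ∃[ y ] (∀ i → coords R i ≈ x * coords P i + y * coords Q i)
    where open Line L

  Matrix₃ : Set c
  Matrix₃ = Vector (Vector Carrier 3) 3

  _*ₘ_ : Matrix₃ → Matrix₃ → Matrix₃
  (A *ₘ B) i j = sum (λ k → A i k * B k j)

  _ᵀ : Matrix₃ → Matrix₃
  (A ᵀ) i j = A j i

  Iₘ : Matrix₃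
  Iₘ i j = if does (i ≟ j) then 1# else 0#

  record GL₃ : Set (c ⊔ ℓ) where
    field
      mat inv  : Matrix₃
      inverseʳ : ∀ i j → (mat *ₘ inv) i j ≈ Iₘ i j
      inverseˡ : ∀ i j → (inv *ₘ mat) i j ≈ Iₘ i j

  toMatrix : Vector Carrier 6 → Matrix₃
  toMatrix y = (y 0F ∷ y 1F ∷ y 2F ∷ [])
             ∷ (y 1F ∷ y 3F ∷ y 4F ∷ [])
             ∷ (y 2F ∷ y 4F ∷ y 5F ∷ [])
             ∷ []

  -- Only ever applied to symmetric matrices, where it inverts toMatrix.
  fromMatrix : Matrix₃ → Vector Carrier 6
  fromMatrix M = M 0F 0F ∷ M 0F 1F ∷ M 0F 2F ∷ M 1F 1F ∷ M 1F 2F ∷ M 2F 2F ∷ []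

  _∙_ : GL₃ → Vector Carrier 6 → Vector Carrier 6
  A ∙ y = fromMatrix ((mat *ₘ toMatrix y) *ₘ (mat ᵀ))
    where open GL₃ A

  image : GL₃ → Pred (Point 5) (c ⊔ ℓ) → Pred (Point 5) (c ⊔ ℓ)
  image A S R = ∃[ P ] S P × coords R ∼ A ∙ coords P

  o₁₀-matrix : (u v₀ x y : Carrier) → Matrix₃
  o₁₀-matrix u v₀ x y = (v₀ * x ∷ y         ∷ 0# ∷ [])
                      ∷ (y      ∷ x + u * y ∷ 0# ∷ [])
                      ∷ (0#     ∷ 0#        ∷ 0# ∷ [])
                      ∷ []

  o₁₀-representative : (u v₀ : Carrier) → Pred (Point 5) (c ⊔ ℓ)
  o₁₀-representative u v₀ R =
    ∃ λ (p : Point 1) →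
      coords R ∼ fromMatrix (o₁₀-matrix u v₀ (coords p 0F) (coords p 1F))

  o₁₀ : Pred (Line 5) (c ⊔ ℓ)
  o₁₀ L =
    ∃[ u ] ∃[ v₀ ] ¬ (v₀ ≈ 0#)
    × (∀ t → ¬ (v₀ * (t * t) + u * v₀ * t - 1# ≈ 0#))
    × ∃ λ (A : GL₃) → points L ≐ image A (o₁₀-representative u v₀)

  -- A hyperplane of PG(5,q) is given by its coefficient vector
  -- (a₀₀, a₀₁, a₀₂, a₁₁, a₁₂, a₂₂), which is also that of the quadratic form
  -- Σ_{i≤j} aᵢⱼ Xᵢ Xⱼ of the corresponding conic.
  Hyperplane : Set (c ⊔ ℓ)
  Hyperplane = Point 5

  _⊇_ : Hyperplane → Line 5 → Set (c ⊔ ℓ)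
  H ⊇ L = ∀ R → points L R → sum (λ i → coords H i * coords R i) ≈ 0#

  hyperplanesThrough : ∀ {p} → Line 5 → Pred Hyperplane p → Setoid (c ⊔ ℓ ⊔ p) (c ⊔ ℓ)
  hyperplanesThrough L 𝒫 = On.setoid (PG 5) (proj₁ {B = λ H → 𝒫 H × H ⊇ L})

  -- Coefficients of (Σ lᵢ Xᵢ) (Σ mᵢ Xᵢ).
  _⊗_ : Vector Carrier 3 → Vector Carrier 3 → Vector Carrier 6
  l ⊗ m = l 0F * m 0F
        ∷ l 0F * m 1F + l 1F * m 0F
        ∷ l 0F * m 2F + l 2F * m 0F
        ∷ l 1F * m 1F
        ∷ l 1F * m 2F + l 2F * m 1F
        ∷ l 2F * m 2F
        ∷ []

  discriminant : Vector Carrier 6 → Carrier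
  discriminant a =
    4 ×ℕ (a₀₀ * a₁₁ * a₂₂) + a₀₁ * a₀₂ * a₁₂
      - a₀₀ * (a₁₂ * a₁₂) - a₁₁ * (a₀₂ * a₀₂) - a₂₂ * (a₀₁ * a₀₁)
    where
    a₀₀ = a 0F
    a₀₁ = a 1F
    a₀₂ = a 2F
    a₁₁ = a 3F
    a₁₂ = a 4F
    a₂₂ = a 5F

  -- As coefficient vectors of hyperplanes are nonzero, all scalars and linear
  -- forms below are automatically nonzero.
  ℋ₁ : Pred Hyperplane (c ⊔ ℓ)
  ℋ₁ H = ∃[ k ] ∃[ l ] (∀ i → coords H i ≈ k * (l ⊗ l) i)

  ℋ₂ᵣ : Pred Hyperplane (c ⊔ ℓ)
  ℋ₂ᵣ H = ∃[ l ] ∃[ m ] ¬ (l ∼ m) × (∀ i → coords H i ≈ (l ⊗ m) i)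

  ℋ₃ : Pred Hyperplane ℓ
  ℋ₃ H = ¬ (discriminant (coords H) ≈ 0#)

module _ {q c ℓ c′ ℓ′} {F : FiniteField q c ℓ} (X : QuadraticExtension F c′ ℓ′) where
  open QuadraticExtension X
  open Projective F
  private
    module F  = FiniteField F
    module E  = FiniteField E
    module PE = Projective E

  ℋ₂ᵢ : Pred Hyperplane (c ⊔ c′ ⊔ ℓ′)
  ℋ₂ᵢ H =
    ∃ λ (k : F.Carrier) → ∃ λ (l : Vector E.Carrier 3) →
      let l̄ = λ i → conj (l i) in
      ¬ (l PE.∼ l̄) × (∀ i → ι (coords H i) E.≈ ι k E.* (l PE.⊗ l̄) i)

  -- OD₄ L (h₁ , h₂ᵣ , h₂ᵢ , h₃) says that the hyperplane-orbit distribution of L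
  -- is [h₁, h₂ᵣ, h₂ᵢ, h₃].
  OD₄ : Line 5 → ℕ × ℕ × ℕ × ℕ → Set (c ⊔ ℓ ⊔ c′ ⊔ ℓ′)
  OD₄ L (h₁ , h₂ᵣ , h₂ᵢ , h₃) =
      HasSize (hyperplanesThrough L ℋ₁)  h₁
    × HasSize (hyperplanesThrough L ℋ₂ᵣ) h₂ᵣ
    × HasSize (hyperplanesThrough L ℋ₂ᵢ) h₂ᵢ
    × HasSize (hyperplanesThrough L ℋ₃)  h₃

{-# OPTIONS --safe #-}

-- Pulling back along the matrix A that carries the representative line to L
-- turns the hyperplanes through L into the quadratic forms whose restriction to
-- X₂ = 0 is s (X₀² + e X₀X₁ − v X₁²), where e = u v₀ and v = v₀. The condition on
-- u and v₀ says that X² + e X − v is irreducible over F. If s = 0 the form is X₂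
-- times a linear form: a double line for X₂² and a real pair otherwise. If s = 1,
-- completing the square gives uniquely (X₀ − z X₁ + γ X₂)(X₀ − z̄ X₁ + γ̄ X₂) + δ X₂²
-- with z, z̄ the roots in E and γ = α − z β, and the discriminant is −(e² + 4v) δ.
-- So the form is a conjugate pair for δ = 0 and nonsingular for δ ≠ 0.
--
-- That z exists and that z̄ = z^q is proved by counting roots: X^(q²) = X holds in
-- F[X]/(X² + e X − v), so X² + e X − v divides X^(q²) − X, which vanishes on E; and
-- (x + y)^q − x^q − y^q has degree < q in x and in y separately.
module Submission where

-- The result covers characteristic 2, so no step may divide by 2. Completing the square amounts to
-- solving `2α + eβ = b`, `eα − 2vβ = c`, a system of determinant `−Δ` with `Δ = e² + 4v`. Its
-- invertibility is read off in `E`, where `Δ = (z − z̄)²`. The value `e = u v₀` comes from the two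
-- conditions `v₀ a₀ + a₃ = 0` and `a₁ + u a₃ = 0` that the representative line imposes on a form.
-- The counts are those of a projective plane plus an affine space: `s = 0` gives `q² + q + 1`
-- points, one of them X₂², and `s = 1` gives the triples (α, β, δ), of which `q²` have `δ = 0` and
-- `q² (q − 1)` do not. `E` is merely some field with `q²` elements that receives a homomorphism
-- from `F`. Neither a generator of `E` nor the additivity of `x ↦ x^q` is part of the data, so both
-- have to be extracted from cardinalities; this is why polynomial functions and their roots appear.

open import Defs
open import Algebra.Bundles using (AbelianGroup; CommutativeRing; RawRing)
import Algebra.Construct.DirectProduct as DirectProduct
open import Algebra.Morphism.Structures using (module RingMorphisms)
import Algebra.Properties.CommutativeMonoid.Sum as CommutativeMonoidSum
import Algebra.Properties.CommutativeSemiring.Exp as CommutativeSemiringExp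
import Algebra.Properties.Ring as RingProperties
open import Data.Bool.Base using (Bool; true; false; T; if_then_else_)
open import Data.Fin.Base using (Fin; zero; suc; _↑ˡ_; _↑ʳ_; combine; remQuot; splitAt; join; punchIn; punchOut; inject≤)
open import Data.Fin.Patterns using (0F; 1F; 2F; 3F; 4F; 5F)
import Data.Fin.Permutation as Perm
import Data.Fin.Properties as Finₚ
open import Data.Integer.Base as ℤ using (ℤ; -[1+_]; 0ℤ; 1ℤ) renaming (+_ to pos)
import Data.Integer.Properties as ℤₚ
open import Data.Maybe.Base using (nothing)
open import Data.Nat.Base as ℕ using (ℕ; zero; suc; z≤n; s≤s; _∸_)
import Data.Nat.Properties as ℕₚ
open import Data.Product.Base using (∃-syntax; _×_; _,_; proj₁; proj₂)
open import Data.Product.Relation.Binary.Pointwise.NonDependent using (×-setoid)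
import Data.Sign.Base as Sign
open import Data.Sum.Base using (_⊎_; inj₁; inj₂; [_,_]′)
open import Data.Sum.Relation.Binary.Pointwise using (⊎-setoid; inj₁; inj₂)
open import Data.Vec.Base as Vec using (Vec)
open import Data.Vec.Functional using (Vector; []; _∷_; removeAt)
open import Data.Vec.N-ary using (N-ary)
open import Function.Base using (_∘_; _$_)
open import Function.Bundles using (Inverse)
open import Level using (Level; _⊔_)
open import Relation.Binary.Bundles using (Setoid)
import Relation.Binary.Construct.On as On
open import Relation.Binary.Definitions using (Decidable)
open import Relation.Binary.PropositionalEquality as ≡ using (_≡_)
import Relation.Binary.Reasoning.Setoid as SetoidReasoning
import Relation.Binary.Reflection as Reflection
open import Relation.Nullary using (¬_; Dec; yes; no; contradiction; does)
open import Relation.Nullary.Decidable using (map′)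
open import Relation.Unary using (_≐_)
open import Tactic.RingSolver.Core.AlmostCommutativeRing using (AlmostCommutativeRing; fromCommutativeRing)
open import Tactic.RingSolver.Core.Expression as Expression using (Expr; Κ; Ι; _⊕_; _⊗_; ⊝_)
import Tactic.RingSolver.Core.Polynomial.Base as PolynomialBase
import Tactic.RingSolver.Core.Polynomial.Homomorphism as PolynomialHomomorphism
open import Tactic.RingSolver.Core.Polynomial.Parameters using (Homomorphism)
import Tactic.RingSolver.Core.Polynomial.Semantics as PolynomialSemantics

-- Polynomial identities with integer coefficients.

-- The library's ring solver takes its coefficients from the ring itself, where
-- 1# - 1# is not recognised as zero; here they are integers.
module IntegerRingSolver {c ℓ} (R : CommutativeRing c ℓ) where
  open CommutativeRing R hiding (zero)
  open import Algebra.Properties.Ring ring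
  open import Algebra.Properties.Semiring.Mult.TCOptimised semiring
    using (×-homo-+; ×1-homo-*; 1+×) renaming (_×_ to _×ℕ_)
  open SetoidReasoning setoid

  -- The multiple used here is the variant optimised for type checking, in which `1 ×ℕ 1#` reduces
  -- to `1#`. Hence `Κ 1ℤ` and `Κ 0ℤ` denote `1#` and `0#` definitionally, and solved equations
  -- apply to goals that mention these constants.
  fromℤ : ℤ → Carrier
  fromℤ (pos n)  = n ×ℕ 1#
  fromℤ -[1+ n ] = - (suc n ×ℕ 1#)

  private
    almostCommutativeRing : AlmostCommutativeRing c ℓ
    almostCommutativeRing = fromCommutativeRing R (λ _ → nothing)

    fromℤ-neg : ∀ i → fromℤ (ℤ.- i) ≈ - fromℤ i
    fromℤ-neg (pos zero)    = sym -0#≈0#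
    fromℤ-neg (pos (suc n)) = refl
    fromℤ-neg -[1+ n ]      = sym (-‿involutive _)

    fromℤ-⊖ : ∀ m n → fromℤ (m ℤ.⊖ n) ≈ m ×ℕ 1# - n ×ℕ 1#
    fromℤ-⊖ zero    zero    = sym (-‿inverseʳ 0#)
    fromℤ-⊖ (suc m) zero    = sym (trans (+-congˡ -0#≈0#) (+-identityʳ _))
    fromℤ-⊖ zero    (suc n) = sym (+-identityˡ _)
    fromℤ-⊖ (suc m) (suc n) = begin
      fromℤ (suc m ℤ.⊖ suc n)                      ≡⟨ ≡.cong fromℤ (ℤₚ.[1+m]⊖[1+n]≡m⊖n m n) ⟩
      fromℤ (m ℤ.⊖ n)                              ≈⟨ fromℤ-⊖ m n ⟩
      m ×ℕ 1# - n ×ℕ 1#                            ≈⟨ +-congʳ (+-identityˡ _) ⟨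
      (0# + m ×ℕ 1#) - n ×ℕ 1#                     ≈⟨ +-congʳ (+-congʳ (-‿inverseʳ 1#)) ⟨
      ((1# - 1#) + m ×ℕ 1#) - n ×ℕ 1#              ≈⟨ +-congʳ (+-assoc _ _ _) ⟩
      (1# + (- 1# + m ×ℕ 1#)) - n ×ℕ 1#            ≈⟨ +-congʳ (+-congˡ (+-comm _ _)) ⟩
      (1# + (m ×ℕ 1# - 1#)) - n ×ℕ 1#              ≈⟨ +-congʳ (+-assoc _ _ _) ⟨
      ((1# + m ×ℕ 1#) - 1#) - n ×ℕ 1#              ≈⟨ +-assoc _ _ _ ⟩
      (1# + m ×ℕ 1#) + (- 1# - n ×ℕ 1#)            ≈⟨ +-congˡ (-‿+-comm _ _) ⟩
      (1# + m ×ℕ 1#) - (1# + n ×ℕ 1#)              ≈⟨ +-cong (1+× m 1#) (-‿cong (1+× n 1#)) ⟨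
      suc m ×ℕ 1# - suc n ×ℕ 1#                    ∎

    fromℤ-+ : ∀ i j → fromℤ (i ℤ.+ j) ≈ fromℤ i + fromℤ j
    fromℤ-+ (pos m)  (pos n)  = ×-homo-+ 1# m n
    fromℤ-+ (pos m)  -[1+ n ] = fromℤ-⊖ m (suc n)
    fromℤ-+ -[1+ m ] (pos n)  = trans (fromℤ-⊖ n (suc m)) (+-comm _ _)
    fromℤ-+ -[1+ m ] -[1+ n ] = begin
      - (suc (suc (m ℕ.+ n)) ×ℕ 1#)       ≡⟨ ≡.cong (λ k → - (suc k ×ℕ 1#)) (ℕₚ.+-suc m n) ⟨
      - ((suc m ℕ.+ suc n) ×ℕ 1#)         ≈⟨ -‿cong (×-homo-+ 1# (suc m) (suc n)) ⟩
      - (suc m ×ℕ 1# + suc n ×ℕ 1#)       ≈⟨ -‿+-comm _ _ ⟨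
      - (suc m ×ℕ 1#) - suc n ×ℕ 1#       ∎

    fromℤ-pos◃ : ∀ n → fromℤ (Sign.+ ℤ.◃ n) ≈ n ×ℕ 1#
    fromℤ-pos◃ zero    = refl
    fromℤ-pos◃ (suc n) = refl

    fromℤ-neg◃ : ∀ n → fromℤ (Sign.- ℤ.◃ n) ≈ - (n ×ℕ 1#)
    fromℤ-neg◃ zero    = sym -0#≈0#
    fromℤ-neg◃ (suc n) = refl

    fromℤ-* : ∀ i j → fromℤ (i ℤ.* j) ≈ fromℤ i * fromℤ j
    fromℤ-* (pos m)  (pos n)  = trans (fromℤ-pos◃ (m ℕ.* n)) (×1-homo-* m n)
    fromℤ-* (pos m)  -[1+ n ] = trans (fromℤ-neg◃ (m ℕ.* suc n))
      (trans (-‿cong (×1-homo-* m (suc n))) (-‿distribʳ-* _ _))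
    fromℤ-* -[1+ m ] (pos n)  = trans (fromℤ-neg◃ (suc m ℕ.* n))
      (trans (-‿cong (×1-homo-* (suc m) n)) (-‿distribˡ-* _ _))
    fromℤ-* -[1+ m ] -[1+ n ] = begin
      fromℤ (Sign.+ ℤ.◃ suc m ℕ.* suc n)   ≈⟨ fromℤ-pos◃ (suc m ℕ.* suc n) ⟩
      (suc m ℕ.* suc n) ×ℕ 1#              ≈⟨ ×1-homo-* (suc m) (suc n) ⟩
      (suc m ×ℕ 1#) * (suc n ×ℕ 1#)        ≈⟨ -‿involutive _ ⟨
      - - ((suc m ×ℕ 1#) * (suc n ×ℕ 1#))  ≈⟨ -‿cong (-‿distribʳ-* _ _) ⟩
      - ((suc m ×ℕ 1#) * - (suc n ×ℕ 1#))  ≈⟨ -‿distribˡ-* _ _ ⟩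
      - (suc m ×ℕ 1#) * - (suc n ×ℕ 1#)    ∎

    isZero : ℤ → Bool
    isZero (pos zero) = true
    isZero _          = false

    isZero-sound : ∀ i → T (isZero i) → 0# ≈ fromℤ i
    isZero-sound (pos zero) _ = refl

    homomorphism : Homomorphism _ _ _ _
    homomorphism = record
      { from     = record { rawRing = ℤ.+-*-rawRing ; isZero = isZero }
      ; to       = almostCommutativeRing
      ; morphism = record
        { ⟦_⟧    = fromℤ
        ; +-homo = fromℤ-+
        ; *-homo = fromℤ-*
        ; -‿homo = fromℤ-neg
        ; 0-homo = refl
        ; 1-homo = refl
        }
      ; Zero-C⟶Zero-R = isZero-sound
      }

    module PB = PolynomialBase (Homomorphism.from homomorphism)
    module PS = PolynomialSemantics homomorphism
    module PH = PolynomialHomomorphism homomorphism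
    open Expression.Eval rawRing fromℤ using (⟦_⟧)
    open import Algebra.Properties.Semiring.Exp.TCOptimised semiring using (^-congˡ)

  normalise : ∀ {n} → Expr ℤ n → PB.Poly n
  normalise (Κ x)   = PB.κ x
  normalise (Ι x)   = PB.ι x
  normalise (x ⊕ y) = normalise x PB.⊞ normalise y
  normalise (x ⊗ y) = normalise x PB.⊠ normalise y
  normalise (⊝ x)   = PB.⊟ normalise x
  normalise (x Expression.⊛ i) = normalise x PB.⊡ i

  private
    correct : ∀ {n} (e : Expr ℤ n) ρ → PS.⟦ normalise e ⟧ ρ ≈ ⟦ e ⟧ ρ
    correct (Κ x)   ρ = PH.κ-hom x ρ
    correct (Ι x)   ρ = PH.ι-hom x ρ
    correct (x ⊕ y) ρ = trans (PH.⊞-hom (normalise x) (normalise y) ρ) (+-cong (correct x ρ) (correct y ρ))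
    correct (x ⊗ y) ρ = trans (PH.⊠-hom (normalise x) (normalise y) ρ) (*-cong (correct x ρ) (correct y ρ))
    correct (⊝ x)   ρ = trans (PH.⊟-hom (normalise x) ρ) (-‿cong (correct x ρ))
    correct (x Expression.⊛ i) ρ = trans (PH.⊡-hom (normalise x) i ρ) (^-congˡ i (correct x ρ))

    module Refl = Reflection setoid Ι ⟦_⟧ (λ e → PS.⟦ normalise e ⟧) correct

  infix 4 _⊜_
  _⊜_ : ∀ {n} → Expr ℤ n → Expr ℤ n → Expr ℤ n × Expr ℤ n
  _⊜_ = _,_

  infixl 6 _⊖_
  _⊖_ : ∀ {n} → Expr ℤ n → Expr ℤ n → Expr ℤ n
  x ⊖ y = x ⊕ ⊝ y

  -- Normal forms are compared as data, which is much faster than comparing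
  -- their values in the abstract ring.
  prove : ∀ {n} (e₁ e₂ : Expr ℤ n) → normalise e₁ ≡ normalise e₂ →
          (ρ : Vec Carrier n) → ⟦ e₁ ⟧ ρ ≈ ⟦ e₂ ⟧ ρ
  prove e₁ e₂ eq ρ = Refl.prove ρ e₁ e₂ (reflexive (≡.cong (λ p → PS.⟦ p ⟧ ρ) eq))

  solve : ∀ n (f : N-ary n (Expr ℤ n) (Expr ℤ n × Expr ℤ n)) →
          let e₁ , e₂ = Refl.close n f in
          normalise e₁ ≡ normalise e₂ →
          (ρ : Vec Carrier n) → ⟦ e₁ ⟧ ρ ≈ ⟦ e₂ ⟧ ρ
  solve n f = prove (proj₁ (Refl.close n f)) (proj₂ (Refl.close n f))

-- Finite fields: Fermat's identity and root counting.

distinct⇒2≤ : ∀ {n} (i j : Fin n) → ¬ i ≡ j → 2 ℕ.≤ n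
distinct⇒2≤ {1}           zero zero i≢j = contradiction ≡.refl i≢j
distinct⇒2≤ {suc (suc n)} _    _    _   = s≤s (s≤s z≤n)

module FiniteFieldProperties {q c ℓ} (F : FiniteField q c ℓ) where
  open FiniteField F hiding (zero)
  open RingProperties ring public
  open CommutativeSemiringExp commutativeSemiring public
    using (^-congˡ; ^-distrib-*)
  open IntegerRingSolver commutativeRing public
  open CommutativeMonoidSum *-commutativeMonoid public
    using ()
    renaming ( sum to product; sum-remove to product-remove; ∑-distrib-+ to ∏-distrib-*
             ; sum-permute to product-permute; sum-cong-≋ to product-cong
             ; sum-replicate to product-replicate; sum-replicate-zero to product-replicate-one )
  open SetoidReasoning setoid

  element : Fin q → Carrier
  element = Inverse.to size

  index : Carrier → Fin q
  index = Inverse.from size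

  element-index : ∀ x → element (index x) ≈ x
  element-index = Inverse.strictlyInverseˡ size

  index-element : ∀ i → index (element i) ≡ i
  index-element = Inverse.strictlyInverseʳ size

  index-injective : ∀ {x y} → index x ≡ index y → x ≈ y
  index-injective {x} {y} eq =
    trans (sym (element-index x)) (trans (reflexive (≡.cong element eq)) (element-index y))

  element-injective : ∀ {i j} → element i ≈ element j → i ≡ j
  element-injective {i} {j} eq =
    ≡.trans (≡.sym (index-element i)) (≡.trans (Inverse.from-cong size eq) (index-element j))

  infix 4 _≟_
  _≟_ : Decidable _≈_
  x ≟ y = map′ index-injective (Inverse.from-cong size) (index x Finₚ.≟ index y)

  2≤q : 2 ℕ.≤ q
  2≤q = distinct⇒2≤ (index 1#) (index 0#) (1≉0 ∘ index-injective)

  x*y≈0⇒y≈0 : ∀ {x y} → ¬ (x ≈ 0#) → x * y ≈ 0# → y ≈ 0#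
  x*y≈0⇒y≈0 {x} {y} x≉0 xy≈0 with inverse x x≉0
  ... | x⁻¹ , xx⁻¹≈1 = begin
    y                ≈⟨ *-identityˡ y ⟨
    1# * y           ≈⟨ *-congʳ xx⁻¹≈1 ⟨
    x * x⁻¹ * y      ≈⟨ *-congʳ (*-comm x x⁻¹) ⟩
    x⁻¹ * x * y      ≈⟨ *-assoc x⁻¹ x y ⟩
    x⁻¹ * (x * y)    ≈⟨ *-congˡ xy≈0 ⟩
    x⁻¹ * 0#         ≈⟨ zeroʳ x⁻¹ ⟩
    0#               ∎

  x*y≈0⇒x≈0⊎y≈0 : ∀ {x y} → x * y ≈ 0# → x ≈ 0# ⊎ y ≈ 0#
  x*y≈0⇒x≈0⊎y≈0 {x} xy≈0 with x ≟ 0#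
  ... | yes x≈0 = inj₁ x≈0
  ... | no  x≉0 = inj₂ (x*y≈0⇒y≈0 x≉0 xy≈0)

  *-nonZero : ∀ {x y} → ¬ (x ≈ 0#) → ¬ (y ≈ 0#) → ¬ (x * y ≈ 0#)
  *-nonZero x≉0 y≉0 = y≉0 ∘ x*y≈0⇒y≈0 x≉0

  x-y≈0⇒x≈y : ∀ {x y} → x - y ≈ 0# → x ≈ y
  x-y≈0⇒x≈y {x} {y} eq = begin
    x            ≈⟨ solve 2 (λ x y → x ⊜ (x ⊖ y) ⊕ y) ≡.refl (x Vec.∷ y Vec.∷ Vec.[]) ⟩
    (x - y) + y  ≈⟨ +-congʳ eq ⟩
    0# + y       ≈⟨ +-identityˡ y ⟩
    y            ∎

  x≈y⇒x-y≈0 : ∀ {x y} → x ≈ y → x - y ≈ 0#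
  x≈y⇒x-y≈0 {x} {y} x≈y = trans (+-congʳ x≈y) (-‿inverseʳ y)

  *-cancelˡ-nonZero : ∀ {x y z} → ¬ (x ≈ 0#) → x * y ≈ x * z → y ≈ z
  *-cancelˡ-nonZero {x} {y} {z} x≉0 eq = x-y≈0⇒x≈y (x*y≈0⇒y≈0 x≉0
    (trans (x[y-z]≈xy-xz x y z) (x≈y⇒x-y≈0 eq)))

  product≈0 : ∀ {n} (t : Vector Carrier n) → product t ≈ 0# → ∃[ i ] t i ≈ 0#
  product≈0 {zero}  t eq = contradiction eq 1≉0
  product≈0 {suc n} t eq with x*y≈0⇒x≈0⊎y≈0 eq
  ... | inj₁ t₀≈0 = zero , t₀≈0
  ... | inj₂ ∏≈0  with product≈0 (t ∘ suc) ∏≈0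
  ...   | i , tᵢ≈0 = suc i , tᵢ≈0

  product-single : ∀ {n} (i : Fin n) (t : Vector Carrier n) →
                   (∀ j → ¬ j ≡ i → t j ≈ 1#) → product t ≈ t i
  product-single {suc n} i t eq = begin
    product t                    ≈⟨ product-remove t ⟩
    t i * product (removeAt t i) ≈⟨ *-congˡ (trans (product-cong (λ j → eq (punchIn i j) (Finₚ.punchInᵢ≢i i j))) (product-replicate-one n)) ⟩
    t i * 1#                     ≈⟨ *-identityʳ (t i) ⟩
    t i                          ∎

  -- The `Fin n` argument encodes `n > 0`; for `n = q` the index of any element supplies it.
  0^n≈0 : ∀ {n} → Fin n → 0# ^ n ≈ 0#
  0^n≈0 {suc n} _ = zeroˡ _

  x^n≈0⇒x≈0 : ∀ n {x} → x ^ n ≈ 0# → x ≈ 0#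
  x^n≈0⇒x≈0 zero    eq = contradiction eq 1≉0
  x^n≈0⇒x≈0 (suc n) eq = [ (λ x≈0 → x≈0) , x^n≈0⇒x≈0 n ]′ (x*y≈0⇒x≈0⊎y≈0 eq)

  private
    -- The decision is an explicit argument so that `pad-cong` can compare independent decisions
    -- about equal elements.
    pad : ∀ {x} → Dec (x ≈ 0#) → Carrier → Carrier → Carrier
    pad (yes _) y z = y
    pad (no  _) y z = z

    pad-cong : ∀ {x x′ y z y′ z′} (d : Dec (x ≈ 0#)) (d′ : Dec (x′ ≈ 0#)) →
               x ≈ x′ → y ≈ y′ → z ≈ z′ → pad d y z ≈ pad d′ y′ z′
    pad-cong (yes _)   (yes _)    _    y≈y′ _    = y≈y′
    pad-cong (no  _)   (no  _)    _    _    z≈z′ = z≈z′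
    pad-cong (yes x≈0) (no x′≉0)  x≈x′ _    _    = contradiction (trans (sym x≈x′) x≈0) x′≉0
    pad-cong (no x≉0)  (yes x′≈0) x≈x′ _    _    = contradiction (trans x≈x′ x′≈0) x≉0

  -- Multiplication by x ≉ 0 permutes the elements; to keep the product of all of
  -- them nonzero, the factor 0 is replaced by 1.
  private
    module _ {x} (x≉0 : ¬ (x ≈ 0#)) where
      x⁻¹ : Carrier
      x⁻¹ = proj₁ (inverse x x≉0)

      nz : Carrier → Carrier
      nz y = pad (y ≟ 0#) 1# y

      nz-cong : ∀ {y z} → y ≈ z → nz y ≈ nz z
      nz-cong y≈z = pad-cong (_ ≟ 0#) (_ ≟ 0#) y≈z refl y≈z

      -- The correction factor between `x * nz y` and `nz (x * y)`: they differ only at `y = 0`,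
      -- where the first is `x` and the second is 1.
      at0 : Carrier → Carrier
      at0 y = pad (y ≟ 0#) x 1#

      scale : Carrier → Fin q → Fin q
      scale a i = index (a * element i)

      scale-inverse : ∀ {a b} → a * b ≈ 1# → ∀ i → scale a (scale b i) ≡ i
      scale-inverse {a} {b} ab≈1 i = element-injective (begin
        element (index (a * element (index (b * element i)))) ≈⟨ element-index _ ⟩
        a * element (index (b * element i))                   ≈⟨ *-congˡ (element-index _) ⟩
        a * (b * element i)                                   ≈⟨ *-assoc _ _ _ ⟨
        a * b * element i                                     ≈⟨ *-congʳ ab≈1 ⟩
        1# * element i                                        ≈⟨ *-identityˡ _ ⟩
        element i                                             ∎)

      π : Perm.Permutation q q
      π = Perm.permutation (scale x) (scale x⁻¹)
            (scale-inverse (proj₂ (inverse x x≉0)))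
            (scale-inverse (trans (*-comm _ _) (proj₂ (inverse x x≉0))))

      P : Carrier
      P = product (λ i → nz (element i))

      P≉0 : ¬ (P ≈ 0#)
      P≉0 eq with product≈0 (λ i → nz (element i)) eq
      ... | i , nz≈0 with element i ≟ 0#
      ...   | yes _ = 1≉0 nz≈0
      ...   | no  y≉0 = y≉0 nz≈0

      x*nz : ∀ y → x * nz y ≈ at0 y * nz (x * y)
      x*nz y with y ≟ 0# | x * y ≟ 0#
      ... | yes _   | yes _    = refl
      ... | yes y≈0 | no xy≉0  = contradiction (trans (*-congˡ y≈0) (zeroʳ x)) xy≉0
      ... | no y≉0  | yes xy≈0 = contradiction xy≈0 (*-nonZero x≉0 y≉0)
      ... | no _    | no _     = sym (*-identityˡ _)

      at0-single : product (λ i → at0 (element i)) ≈ x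
      at0-single = trans (product-single (index 0#) _ off) on
        where
        on : at0 (element (index 0#)) ≈ x
        on with element (index 0#) ≟ 0#
        ... | yes _ = refl
        ... | no ≉0 = contradiction (element-index 0#) ≉0
        off : ∀ j → ¬ j ≡ index 0# → at0 (element j) ≈ 1#
        off j j≢ with element j ≟ 0#
        ... | yes ≈0 = contradiction (element-injective (trans ≈0 (sym (element-index 0#)))) j≢
        ... | no _ = refl

      -- Multiply `x * nz y` over all `y`. Pulling out `x` gives `x ^ q * P`; moving `x` inside
      -- gives one surviving correction factor `x` times a permuted copy of `P`. Cancelling `P`
      -- yields the exponent `q` directly, without passing through `q − 1`.
      fermat-nonZero : x ^ q ≈ x
      fermat-nonZero = *-cancelˡ-nonZero P≉0 (begin
        P * x ^ q                                          ≈⟨ *-comm _ _ ⟩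
        x ^ q * P                                          ≈⟨ *-congʳ (product-replicate q) ⟨
        product {q} (λ _ → x) * P                          ≈⟨ ∏-distrib-* (λ _ → x) (λ i → nz (element i)) ⟨
        product (λ i → x * nz (element i))                 ≈⟨ product-cong (λ i → x*nz (element i)) ⟩
        product (λ i → at0 (element i) * nz (x * element i))
          ≈⟨ ∏-distrib-* (λ i → at0 (element i)) (λ i → nz (x * element i)) ⟩
        product (λ i → at0 (element i)) * product (λ i → nz (x * element i))
          ≈⟨ *-cong at0-single (product-cong {q} (λ i → nz-cong (sym (element-index _)))) ⟩
        x * product (λ i → nz (element (scale x i)))       ≈⟨ *-congˡ (product-permute (λ i → nz (element i)) π) ⟨
        x * P                                              ≈⟨ *-comm _ _ ⟩
        P * x                                              ∎)

  fermat : ∀ x → x ^ q ≈ x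
  fermat x with x ≟ 0#
  ... | yes x≈0 = trans (^-congˡ q x≈0) (trans (0^n≈0 (index 0#)) (sym x≈0))
  ... | no  x≉0 = fermat-nonZero x≉0

  -- g is a polynomial function whose coefficient of degree n is a and whose
  -- higher coefficients vanish, in Horner form.
  data IsPolynomial (a : Carrier) : ℕ → (Carrier → Carrier) → Set (c ⊔ ℓ) where
    constant : ∀ {g} → (∀ x → g x ≈ a) → IsPolynomial a 0 g
    horner   : ∀ {n g h} c₀ → IsPolynomial a n h → (∀ x → g x ≈ c₀ + x * h x) →
               IsPolynomial a (suc n) g

  -- The degree is kept positive because in degree 0 the added constant would change the leading
  -- coefficient.
  +-constant : ∀ {a n g} c₁ → IsPolynomial a (suc n) g → IsPolynomial a (suc n) (λ x → g x + c₁)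
  +-constant c₁ (horner c₀ h eq) = horner (c₀ + c₁) h λ x →
    trans (+-congʳ (eq x)) (solve 3 (λ a b c → (a ⊕ b) ⊕ c ⊜ (a ⊕ c) ⊕ b) ≡.refl (_ Vec.∷ _ Vec.∷ _ Vec.∷ Vec.[]))

  x*-polynomial : ∀ {a n g} → IsPolynomial a n g → IsPolynomial a (suc n) (λ x → x * g x)
  x*-polynomial p = horner 0# p λ x → sym (+-identityˡ _)

  ^-polynomial : ∀ n → IsPolynomial 1# n (_^ n)
  ^-polynomial zero    = constant λ _ → refl
  ^-polynomial (suc n) = x*-polynomial (^-polynomial n)

  [x+y]*-polynomial : ∀ {a n g} y → IsPolynomial a n g → IsPolynomial a (suc n) (λ x → (x + y) * g x)
  [x+y]*-polynomial {a} y (constant eq) = horner (y * a) (constant λ _ → refl) λ x →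
    trans (*-congˡ (eq x)) (solve 3 (λ x y a → (x ⊕ y) ⊗ a ⊜ y ⊗ a ⊕ x ⊗ a) ≡.refl (x Vec.∷ y Vec.∷ a Vec.∷ Vec.[]))
  [x+y]*-polynomial y (horner {h = h} c₀ p eq) =
    horner (y * c₀) (+-constant c₀ ([x+y]*-polynomial y p)) λ x →
    trans (*-congˡ (eq x))
      (solve 4 (λ x y c h → (x ⊕ y) ⊗ (c ⊕ x ⊗ h) ⊜ y ⊗ c ⊕ x ⊗ ((x ⊕ y) ⊗ h ⊕ c)) ≡.refl (x Vec.∷ y Vec.∷ c₀ Vec.∷ h x Vec.∷ Vec.[]))

  [x+y]^-polynomial : ∀ y n → IsPolynomial 1# n (λ x → (x + y) ^ n)
  [x+y]^-polynomial y zero    = constant λ _ → refl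
  [x+y]^-polynomial y (suc n) = [x+y]*-polynomial y ([x+y]^-polynomial y n)

  -- The index is a formal degree: it stays `n` even when `a - b` is zero. That case is the useful
  -- one, since a formal degree `n` with leading coefficient 0 and `n` roots forces the zero
  -- function.
  ∸-polynomial : ∀ {a b n g h} → IsPolynomial a n g → IsPolynomial b n h →
                 IsPolynomial (a - b) n (λ x → g x - h x)
  ∸-polynomial (constant eq₁) (constant eq₂) = constant λ x → +-cong (eq₁ x) (-‿cong (eq₂ x))
  ∸-polynomial (horner c₁ p₁ eq₁) (horner c₂ p₂ eq₂) = horner (c₁ - c₂) (∸-polynomial p₁ p₂) λ x →
    trans (+-cong (eq₁ x) (-‿cong (eq₂ x)))
      (solve 5 (λ x c d g h → (c ⊕ x ⊗ g) ⊖ (d ⊕ x ⊗ h) ⊜ (c ⊖ d) ⊕ x ⊗ (g ⊖ h)) ≡.refl (x Vec.∷ _ Vec.∷ _ Vec.∷ _ Vec.∷ _ Vec.∷ Vec.[]))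

  -- Division by `X − r` on Horner forms. A remainder `g r` is allowed because the recursion divides
  -- the inner polynomial `h`, which has no reason to vanish at `r`.
  factorAt : ∀ {a n g} → IsPolynomial a (suc n) g → ∀ r →
             ∃[ h ] IsPolynomial a n h × (∀ x → g x ≈ g r + (x - r) * h x)
  factorAt {a} (horner {g = g} c₀ (constant eq₀) eq) r =
    (λ _ → a) , constant (λ _ → refl) , λ x → begin
      g x                          ≈⟨ trans (eq x) (+-congˡ (*-congˡ (eq₀ x))) ⟩
      c₀ + x * a                   ≈⟨ solve 4 (λ c x a r → c ⊕ x ⊗ a ⊜ (c ⊕ r ⊗ a) ⊕ (x ⊖ r) ⊗ a) ≡.refl (c₀ Vec.∷ x Vec.∷ a Vec.∷ r Vec.∷ Vec.[]) ⟩
      (c₀ + r * a) + (x - r) * a   ≈⟨ +-congʳ (trans (eq r) (+-congˡ (*-congˡ (eq₀ r)))) ⟨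
      g r + (x - r) * a            ∎
  factorAt {a} (horner {g = g} {h} c₀ p@(horner _ _ _) eq) r with factorAt p r
  ... | k , pk , eqk = (λ x → x * k x + h r) , +-constant (h r) (x*-polynomial pk) , λ x → begin
      g x                                     ≈⟨ trans (eq x) (+-congˡ (*-congˡ (eqk x))) ⟩
      c₀ + x * (h r + (x - r) * k x)
        ≈⟨ solve 5 (λ c x k r h → c ⊕ x ⊗ (h ⊕ (x ⊖ r) ⊗ k) ⊜ (c ⊕ r ⊗ h) ⊕ (x ⊖ r) ⊗ (x ⊗ k ⊕ h)) ≡.refl (c₀ Vec.∷ x Vec.∷ k x Vec.∷ r Vec.∷ h r Vec.∷ Vec.[]) ⟩
      (c₀ + r * h r) + (x - r) * (x * k x + h r) ≈⟨ +-congʳ (eq r) ⟨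
      g r + (x - r) * (x * k x + h r)         ∎

  -- Each root lowers the formal degree by one and keeps the leading coefficient, so after `n` roots
  -- only the constant `a` is left. It is applied with `a = 1` to split a monic polynomial and with
  -- `a = 1# - 1#` to show that a function vanishes.
  factorByRoots : ∀ {a n g} → IsPolynomial a n g → (r : Vector Carrier n) →
                  (∀ {i j} → r i ≈ r j → i ≡ j) → (∀ i → g (r i) ≈ 0#) →
                  ∀ x → g x ≈ a * product (λ i → x - r i)
  factorByRoots (constant eq) r inj root x = trans (eq x) (sym (*-identityʳ _))
  factorByRoots {a} {suc n} {g} p r inj root x with factorAt p (r zero)
  ... | h , ph , eqh = begin
    g x                                                        ≈⟨ factored x ⟩
    (x - r zero) * h x                                         ≈⟨ *-congˡ (factorByRoots ph (r ∘ suc) (Finₚ.suc-injective ∘ inj) root′ x) ⟩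
    (x - r zero) * (a * product (λ i → x - r (suc i)))
      ≈⟨ solve 3 (λ x a p → x ⊗ (a ⊗ p) ⊜ a ⊗ (x ⊗ p)) ≡.refl (x - r zero Vec.∷ a Vec.∷ product (λ i → x - r (suc i)) Vec.∷ Vec.[]) ⟩
    a * product (λ i → x - r i)                                ∎
    where
    factored : ∀ y → g y ≈ (y - r zero) * h y
    factored y = trans (eqh y) (trans (+-congʳ (root zero)) (+-identityˡ _))
    root′ : ∀ i → h (r (suc i)) ≈ 0#
    root′ i = x*y≈0⇒y≈0 (λ eq → Finₚ.0≢1+n (≡.sym (inj (x-y≈0⇒x≈y eq))))
                        (trans (sym (factored _)) (root (suc i)))

  -- Of `n + 1` distinct elements, `n` are used as roots; at the remaining one the resulting product
  -- of nonzero differences would have to be zero.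
  monic-nonvanishing : ∀ {n g} → n ℕ.< q → IsPolynomial 1# n g → ¬ (∀ x → g x ≈ 0#)
  monic-nonvanishing {n} n<q p g≈0 = Finₚ.0≢1+n (r-injective (x-y≈0⇒x≈y (proj₂ zero-factor)))
    where
    r : Vector Carrier (suc n)
    r i = element (inject≤ i n<q)
    r-injective : ∀ {i j} → r i ≈ r j → i ≡ j
    r-injective eq = Finₚ.inject≤-injective n<q n<q _ _ (element-injective eq)
    zero-factor : ∃[ i ] r zero - r (suc i) ≈ 0#
    zero-factor = product≈0 _ (trans (sym (trans
      (factorByRoots p (r ∘ suc) (Finₚ.suc-injective ∘ r-injective) (λ _ → g≈0 _) (r zero))
      (*-identityˡ _))) (g≈0 (r zero)))

  -- The inverse of a root of X² + e X − v is minus a root of v X² + e X − 1.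
  reversed-irreducible : ∀ {e v} → ¬ (v ≈ 0#) → (∀ t → ¬ (v * (t * t) + e * t - 1# ≈ 0#)) →
                         ∀ x → ¬ (x * x + e * x - v ≈ 0#)
  reversed-irreducible {e} {v} v≉0 no-root x fx≈0 with inverse x (λ x≈0 → v≉0 (begin
      v                                     ≈⟨ solve 3 (λ e v x → v ⊜ x ⊗ (x ⊕ e) ⊖ (x ⊗ x ⊕ e ⊗ x ⊖ v)) ≡.refl (e Vec.∷ v Vec.∷ x Vec.∷ Vec.[]) ⟩
      x * (x + e) - (x * x + e * x - v)     ≈⟨ +-cong (trans (*-congʳ x≈0) (zeroˡ _)) (-‿cong fx≈0) ⟩
      0# - 0#                               ≈⟨ -‿inverseʳ 0# ⟩
      0#                                    ∎))
  ... | w , xw≈1 = no-root (- w) (begin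
    v * (- w * - w) + e * - w - 1#
      ≈⟨ solve 4 (λ e v x w → v ⊗ (⊝ w ⊗ ⊝ w) ⊕ e ⊗ ⊝ w ⊖ Κ 1ℤ ⊜
           ⊝ (w ⊗ w ⊗ (x ⊗ x ⊕ e ⊗ x ⊖ v)) ⊕ (x ⊗ w ⊖ Κ 1ℤ) ⊗ (x ⊗ w ⊕ Κ 1ℤ ⊕ e ⊗ w)) ≡.refl
           (e Vec.∷ v Vec.∷ x Vec.∷ w Vec.∷ Vec.[]) ⟩
    - (w * w * (x * x + e * x - v)) + (x * w - 1#) * (x * w + 1# + e * w)
      ≈⟨ +-cong (-‿cong (trans (*-congˡ fx≈0) (zeroʳ _))) (trans (*-congʳ (x≈y⇒x-y≈0 xw≈1)) (zeroˡ _)) ⟩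
    - 0# + 0#   ≈⟨ -‿inverseˡ 0# ⟩
    0#          ∎)

-- Sizes of setoids: products, disjoint sums, removal of a point.

private
  variable
    c₁ c₂ ℓ₁ ℓ₂ : Level

enumerate : ∀ {n} (S : Setoid c₁ ℓ₁) → let open Setoid S in (f : Fin n → Carrier) →
            (∀ {i j} → f i ≈ f j → i ≡ j) → (∀ x → ∃[ i ] f i ≈ x) → HasSize S n
enumerate S f inj surj = record
  { to        = f
  ; from      = proj₁ ∘ surj
  ; to-cong   = λ { ≡.refl → refl }
  ; from-cong = λ {x} {y} x≈y → inj (trans (proj₂ (surj x)) (trans x≈y (sym (proj₂ (surj y)))))
  ; inverse   = (λ { {x} ≡.refl → proj₂ (surj x) })
              , (λ {i} {x} x≈ → inj (trans (proj₂ (surj x)) x≈))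
  }
  where open Setoid S

transfer : ∀ {n} {S : Setoid c₁ ℓ₁} (T : Setoid c₂ ℓ₂) →
           let _≈₁_ = Setoid._≈_ S; _≈₂_ = Setoid._≈_ T in
           (f : Setoid.Carrier S → Setoid.Carrier T) →
           (∀ {x y} → x ≈₁ y → f x ≈₂ f y) → (∀ {x y} → f x ≈₂ f y → x ≈₁ y) →
           (∀ y → ∃[ x ] f x ≈₂ y) → HasSize S n → HasSize T n
transfer {S = S} T f cong inj surj size = enumerate T (f ∘ to)
  (λ {i} {j} eq → ≡.trans (≡.sym (strictlyInverseʳ i))
                    (≡.trans (from-cong (inj eq)) (strictlyInverseʳ j)))
  (λ y → from (proj₁ (surj y)) , T.trans (cong (strictlyInverseˡ _)) (proj₂ (surj y)))
  where
  open Inverse size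
  module T = Setoid T

to-injective : ∀ {n} {S : Setoid c₁ ℓ₁} (size : HasSize S n) →
               ∀ {i j} → Setoid._≈_ S (Inverse.to size i) (Inverse.to size j) → i ≡ j
to-injective size eq = ≡.trans (≡.sym (Inverse.strictlyInverseʳ size _))
  (≡.trans (Inverse.from-cong size eq) (Inverse.strictlyInverseʳ size _))

×-size : ∀ {m n} {S : Setoid c₁ ℓ₁} {T : Setoid c₂ ℓ₂} →
         HasSize S m → HasSize T n → HasSize (×-setoid S T) (m ℕ.* n)
×-size {m = m} {n} {S} {T} s t = enumerate (×-setoid S T)
  (λ i → let j , k = remQuot {m} n i in s.to j , t.to k)
  (λ {i} {j} (eq₁ , eq₂) → ≡.trans (≡.sym (Finₚ.combine-remQuot {m} n i)) (≡.trans
     (≡.cong₂ combine (to-injective s eq₁) (to-injective t eq₂)) (Finₚ.combine-remQuot {m} n j)))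
  (λ (x , y) → combine (s.from x) (t.from y) ,
     ≡.subst (λ (j , k) → Setoid._≈_ (×-setoid S T) (s.to j , t.to k) (x , y))
       (≡.sym (Finₚ.remQuot-combine (s.from x) (t.from y)))
       (s.strictlyInverseˡ x , t.strictlyInverseˡ y))
  where
  module s = Inverse s
  module t = Inverse t

Fin1-unique : (i j : Fin 1) → i ≡ j
Fin1-unique 0F 0F = ≡.refl

⊎-size : ∀ {m n} {S : Setoid c₁ ℓ₁} {T : Setoid c₂ ℓ₂} →
         HasSize S m → HasSize T n → HasSize (⊎-setoid S T) (m ℕ.+ n)
⊎-size {m = m} {n} {S} {T} s t = enumerate (⊎-setoid S T) (f ∘ splitAt m)
  (λ {i} {j} eq → ≡.trans (≡.sym (Finₚ.join-splitAt m n i))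
    (≡.trans (≡.cong (join m n) (f-injective (splitAt m i) (splitAt m j) eq)) (Finₚ.join-splitAt m n j)))
  (λ x → join m n (g x) , ≡.subst (λ i → f i ≈ x) (≡.sym (Finₚ.splitAt-join m n (g x))) (f∘g x))
  where
  open Setoid (⊎-setoid S T)
  module s = Inverse s
  module t = Inverse t
  f : Fin m ⊎ Fin n → Carrier
  f (inj₁ i) = inj₁ (s.to i)
  f (inj₂ i) = inj₂ (t.to i)
  g : Carrier → Fin m ⊎ Fin n
  g (inj₁ x) = inj₁ (s.from x)
  g (inj₂ x) = inj₂ (t.from x)
  f-injective : ∀ i j → f i ≈ f j → i ≡ j
  f-injective (inj₁ i) (inj₁ j) (inj₁ eq) = ≡.cong inj₁ (to-injective s eq)
  f-injective (inj₂ i) (inj₂ j) (inj₂ eq) = ≡.cong inj₂ (to-injective t eq)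
  f∘g : ∀ x → f (g x) ≈ x
  f∘g (inj₁ x) = inj₁ (s.strictlyInverseˡ x)
  f∘g (inj₂ x) = inj₂ (t.strictlyInverseˡ x)

without : (S : Setoid c₁ ℓ₁) → Setoid.Carrier S → Setoid (c₁ ⊔ ℓ₁) ℓ₁
without S x = On.setoid S (proj₁ {B = λ y → ¬ (Setoid._≈_ S y x)})

without-size : ∀ {n} {S : Setoid c₁ ℓ₁} x → HasSize S n → HasSize (without S x) (n ∸ 1)
without-size {n = zero}  x size with () ← Inverse.from size x
without-size {n = suc n} {S} x size = enumerate (without S x)
  (λ i → to (punchIn (from x) i) , λ eq → Finₚ.punchInᵢ≢i (from x) i (≡.trans (≡.sym (strictlyInverseʳ _)) (from-cong eq)))
  (λ eq → Finₚ.punchIn-injective (from x) _ _ (to-injective size eq))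
  (λ (y , y≉x) → let x≢y = λ eq → y≉x (trans (sym (strictlyInverseˡ y)) (trans (to-cong (≡.sym eq)) (strictlyInverseˡ x))) in
     punchOut {i = from x} x≢y
     , trans (to-cong (Finₚ.punchIn-punchOut x≢y)) (strictlyInverseˡ y))
  where
  open Setoid S
  open Inverse size

-- The quadratic quotient as a field with `q²` elements.

Irreducible : ∀ {q c ℓ} (F : FiniteField q c ℓ) (e v : FiniteField.Carrier F) → Set (c ⊔ ℓ)
Irreducible F e v = ∀ x → ¬ (x * x + e * x - v ≈ 0#)
  where open FiniteField F

-- The field F[X]/(X² + e X − v), with a + b X represented by (a , b).
module QuadraticQuotient {q c ℓ} (F : FiniteField q c ℓ) (e v : FiniteField.Carrier F)
  (irreducible : Irreducible F e v) where
  open FiniteField F hiding (zero)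
  open FiniteFieldProperties F
  open SetoidReasoning setoid

  infixl 7 _⊛_
  -- Multiplication followed by the reduction `X² = v − e X`.
  _⊛_ : Carrier × Carrier → Carrier × Carrier → Carrier × Carrier
  (a , b) ⊛ (c , d) = a * c + v * (b * d) , a * d + b * c - e * (b * d)

  private
    module +-group = AbelianGroup (DirectProduct.abelianGroup +-abelianGroup +-abelianGroup)
    module +ₛ = Setoid (×-setoid setoid setoid)

    -- The product of `a + b X` with its conjugate `(a − e b) − b X`, obtained from `X ↦ − e − X`;
    -- dividing the conjugate by it gives the inverse in `field²`.
    norm : Carrier → Carrier → Carrier
    norm a b = a * a - e * (a * b) - v * (b * b)

    -- For `b ≠ 0` the norm is `b²` times the value of `X² + e X − v` at `− a / b`, so a zero norm
    -- would produce a root in `F`.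
    norm≉0 : ∀ a b → ¬ (a ≈ 0# × b ≈ 0#) → ¬ (norm a b ≈ 0#)
    norm≉0 a b ab≉0 n≈0 with b ≟ 0#
    ... | yes b≈0 = ab≉0 (a≈0 , b≈0)
      where
      a²≈0 : a * a ≈ 0#
      a²≈0 = begin
        a * a                                   ≈⟨ solve 4 (λ a b e v → a ⊗ a ⊜ (a ⊗ a ⊖ e ⊗ (a ⊗ b) ⊖ v ⊗ (b ⊗ b)) ⊕ b ⊗ (e ⊗ a ⊕ v ⊗ b)) ≡.refl (a Vec.∷ b Vec.∷ e Vec.∷ v Vec.∷ Vec.[]) ⟩
        norm a b + b * (e * a + v * b)          ≈⟨ +-cong n≈0 (trans (*-congʳ b≈0) (zeroˡ _)) ⟩
        0# + 0#                                 ≈⟨ +-identityˡ 0# ⟩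
        0#                                      ∎
      a≈0 : a ≈ 0#
      a≈0 = [ (λ z → z) , (λ z → z) ]′ (x*y≈0⇒x≈0⊎y≈0 a²≈0)
    ... | no b≉0 with inverse b b≉0
    ...   | w , bw≈1 = irreducible (- (a * w)) (begin
      (- (a * w)) * (- (a * w)) + e * (- (a * w)) - v
        ≈⟨ solve 5 (λ a b w e v → (⊝ (a ⊗ w)) ⊗ (⊝ (a ⊗ w)) ⊕ e ⊗ (⊝ (a ⊗ w)) ⊖ v ⊜ w ⊗ w ⊗ (a ⊗ a ⊖ e ⊗ (a ⊗ b) ⊖ v ⊗ (b ⊗ b)) ⊕ (b ⊗ w ⊖ Κ 1ℤ) ⊗ (e ⊗ a ⊗ w ⊕ v ⊗ (b ⊗ w ⊕ Κ 1ℤ))) ≡.refl (a Vec.∷ b Vec.∷ w Vec.∷ e Vec.∷ v Vec.∷ Vec.[]) ⟩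
      w * w * norm a b + (b * w - 1#) * (e * a * w + v * (b * w + 1#))
        ≈⟨ +-cong (trans (*-congˡ n≈0) (zeroʳ _)) (trans (*-congʳ (x≈y⇒x-y≈0 bw≈1)) (zeroˡ _)) ⟩
      0# + 0#     ≈⟨ +-identityˡ 0# ⟩
      0#          ∎)

  ring² : CommutativeRing _ _
  ring² = record
    { Carrier = Carrier × Carrier
    ; _≈_ = +ₛ._≈_
    ; _+_ = +-group._∙_
    ; _*_ = _⊛_
    ; -_  = +-group._⁻¹
    ; 0#  = +-group.ε
    ; 1#  = 1# , 0#
    ; isCommutativeRing = record
      { isRing = record
        { +-isAbelianGroup = +-group.isAbelianGroup
        ; *-cong     = λ (a≈ , b≈) (c≈ , d≈) →
            +-cong (*-cong a≈ c≈) (*-congˡ (*-cong b≈ d≈))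
            , +-cong (+-cong (*-cong a≈ d≈) (*-cong b≈ c≈)) (-‿cong (*-congˡ (*-cong b≈ d≈)))
        ; *-assoc    = λ (a , b) (c , d) (f , g) →
            solve 8 (λ e v a b c d f g → (a ⊗ c ⊕ v ⊗ (b ⊗ d)) ⊗ f ⊕ v ⊗ ((a ⊗ d ⊕ b ⊗ c ⊖ e ⊗ (b ⊗ d)) ⊗ g) ⊜ a ⊗ (c ⊗ f ⊕ v ⊗ (d ⊗ g)) ⊕ v ⊗ (b ⊗ (c ⊗ g ⊕ d ⊗ f ⊖ e ⊗ (d ⊗ g)))) ≡.refl (e Vec.∷ v Vec.∷ a Vec.∷ b Vec.∷ c Vec.∷ d Vec.∷ f Vec.∷ g Vec.∷ Vec.[])
            , solve 8 (λ e v a b c d f g → (a ⊗ c ⊕ v ⊗ (b ⊗ d)) ⊗ g ⊕ (a ⊗ d ⊕ b ⊗ c ⊖ e ⊗ (b ⊗ d)) ⊗ f ⊖ e ⊗ ((a ⊗ d ⊕ b ⊗ c ⊖ e ⊗ (b ⊗ d)) ⊗ g) ⊜ a ⊗ (c ⊗ g ⊕ d ⊗ f ⊖ e ⊗ (d ⊗ g)) ⊕ b ⊗ (c ⊗ f ⊕ v ⊗ (d ⊗ g)) ⊖ e ⊗ (b ⊗ (c ⊗ g ⊕ d ⊗ f ⊖ e ⊗ (d ⊗ g)))) ≡.refl (e Vec.∷ v Vec.∷ a Vec.∷ b Vec.∷ c Vec.∷ d Vec.∷ f Vec.∷ g Vec.∷ Vec.[])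
        ; *-identity = (λ (a , b) →
            solve 4 (λ e v a b → Κ 1ℤ ⊗ a ⊕ v ⊗ (Κ 0ℤ ⊗ b) ⊜ a) ≡.refl (e Vec.∷ v Vec.∷ a Vec.∷ b Vec.∷ Vec.[])
            , solve 4 (λ e v a b → Κ 1ℤ ⊗ b ⊕ Κ 0ℤ ⊗ a ⊖ e ⊗ (Κ 0ℤ ⊗ b) ⊜ b) ≡.refl (e Vec.∷ v Vec.∷ a Vec.∷ b Vec.∷ Vec.[]))
          , (λ (a , b) →
            solve 4 (λ e v a b → a ⊗ Κ 1ℤ ⊕ v ⊗ (b ⊗ Κ 0ℤ) ⊜ a) ≡.refl (e Vec.∷ v Vec.∷ a Vec.∷ b Vec.∷ Vec.[])
            , solve 4 (λ e v a b → a ⊗ Κ 0ℤ ⊕ b ⊗ Κ 1ℤ ⊖ e ⊗ (b ⊗ Κ 0ℤ) ⊜ b) ≡.refl (e Vec.∷ v Vec.∷ a Vec.∷ b Vec.∷ Vec.[]))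
        ; distrib    = (λ (a , b) (c , d) (f , g) →
            solve 8 (λ e v a b c d f g → a ⊗ (c ⊕ f) ⊕ v ⊗ (b ⊗ (d ⊕ g)) ⊜ (a ⊗ c ⊕ v ⊗ (b ⊗ d)) ⊕ (a ⊗ f ⊕ v ⊗ (b ⊗ g))) ≡.refl (e Vec.∷ v Vec.∷ a Vec.∷ b Vec.∷ c Vec.∷ d Vec.∷ f Vec.∷ g Vec.∷ Vec.[])
            , solve 8 (λ e v a b c d f g → a ⊗ (d ⊕ g) ⊕ b ⊗ (c ⊕ f) ⊖ e ⊗ (b ⊗ (d ⊕ g)) ⊜ (a ⊗ d ⊕ b ⊗ c ⊖ e ⊗ (b ⊗ d)) ⊕ (a ⊗ g ⊕ b ⊗ f ⊖ e ⊗ (b ⊗ g))) ≡.refl (e Vec.∷ v Vec.∷ a Vec.∷ b Vec.∷ c Vec.∷ d Vec.∷ f Vec.∷ g Vec.∷ Vec.[]))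
          , (λ (a , b) (c , d) (f , g) →
            solve 8 (λ e v a b c d f g → (c ⊕ f) ⊗ a ⊕ v ⊗ ((d ⊕ g) ⊗ b) ⊜ (c ⊗ a ⊕ v ⊗ (d ⊗ b)) ⊕ (f ⊗ a ⊕ v ⊗ (g ⊗ b))) ≡.refl (e Vec.∷ v Vec.∷ a Vec.∷ b Vec.∷ c Vec.∷ d Vec.∷ f Vec.∷ g Vec.∷ Vec.[])
            , solve 8 (λ e v a b c d f g → (c ⊕ f) ⊗ b ⊕ (d ⊕ g) ⊗ a ⊖ e ⊗ ((d ⊕ g) ⊗ b) ⊜ (c ⊗ b ⊕ d ⊗ a ⊖ e ⊗ (d ⊗ b)) ⊕ (f ⊗ b ⊕ g ⊗ a ⊖ e ⊗ (g ⊗ b))) ≡.refl (e Vec.∷ v Vec.∷ a Vec.∷ b Vec.∷ c Vec.∷ d Vec.∷ f Vec.∷ g Vec.∷ Vec.[]))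
        }
      ; *-comm = λ (a , b) (c , d) →
          solve 5 (λ v a b c d → a ⊗ c ⊕ v ⊗ (b ⊗ d) ⊜ c ⊗ a ⊕ v ⊗ (d ⊗ b)) ≡.refl (v Vec.∷ a Vec.∷ b Vec.∷ c Vec.∷ d Vec.∷ Vec.[])
          , solve 5 (λ e a b c d → a ⊗ d ⊕ b ⊗ c ⊖ e ⊗ (b ⊗ d) ⊜ c ⊗ b ⊕ d ⊗ a ⊖ e ⊗ (d ⊗ b)) ≡.refl (e Vec.∷ a Vec.∷ b Vec.∷ c Vec.∷ d Vec.∷ Vec.[])
      }
    }

  field² : FiniteField (q ℕ.^ 2) c ℓ
  field² = record
    { commutativeRing = ring²
    ; 1≉0     = 1≉0 ∘ proj₁
    ; inverse = λ (a , b) ab≉0 → let n⁻¹ , nn⁻¹≈1 = inverse (norm a b) (norm≉0 a b ab≉0) in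
        ((a - e * b) * n⁻¹ , - b * n⁻¹)
        , trans (solve 5 (λ e v a b w → a ⊗ ((a ⊖ e ⊗ b) ⊗ w) ⊕ v ⊗ (b ⊗ (⊝ b ⊗ w)) ⊜ (a ⊗ a ⊖ e ⊗ (a ⊗ b) ⊖ v ⊗ (b ⊗ b)) ⊗ w) ≡.refl (e Vec.∷ v Vec.∷ a Vec.∷ b Vec.∷ n⁻¹ Vec.∷ Vec.[])) nn⁻¹≈1
        , solve 5 (λ e v a b w → a ⊗ (⊝ b ⊗ w) ⊕ b ⊗ ((a ⊖ e ⊗ b) ⊗ w) ⊖ e ⊗ (b ⊗ (⊝ b ⊗ w)) ⊜ Κ 0ℤ) ≡.refl (e Vec.∷ v Vec.∷ a Vec.∷ b Vec.∷ n⁻¹ Vec.∷ Vec.[])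
    ; size    = ≡.subst (λ n → HasSize (×-setoid setoid setoid) n) (≡.cong (q ℕ.*_) (≡.sym (ℕₚ.*-identityʳ q))) (×-size size size)
    }

-- The Frobenius map on `E` and the conjugate roots.

record ConjugateRoots {q c ℓ c′ ℓ′} {F : FiniteField q c ℓ} (X : QuadraticExtension F c′ ℓ′)
                      (e v : FiniteField.Carrier F) : Set (c′ ⊔ ℓ′) where
  open QuadraticExtension X
  open FiniteField E
  field
    z    : Carrier
    -- Vieta's relations are recorded instead of the equation of `z`: they are what the
    -- factorisation over `E` and the formula for `Δ` consume.
    z+z̄ : z + conj z ≈ - ι e
    zz̄  : z * conj z ≈ - ι v
    z≉z̄ : ¬ (z ≈ conj z)

module QuadraticExtensionProperties {q c ℓ c′ ℓ′} {F : FiniteField q c ℓ}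
  (X : QuadraticExtension F c′ ℓ′) where
  open QuadraticExtension X
  private
    module F  = FiniteField F
    module FP = FiniteFieldProperties F
    module S  = IntegerRingSolver F.commutativeRing
  open FiniteField E hiding (zero)
  open FiniteFieldProperties E
  open RingMorphisms.IsRingHomomorphism isRingHomomorphism public
    using ()
    renaming ( ⟦⟧-cong to ι-cong; +-homo to ι-+; *-homo to ι-*; -‿homo to ι-neg
             ; 0#-homo to ι-0; 1#-homo to ι-1 )
  open SetoidReasoning setoid

  ι-∸ : ∀ x y → ι (x F.- y) ≈ ι x - ι y
  ι-∸ x y = trans (ι-+ x (F.- y)) (+-congˡ (ι-neg y))

  ι-≉0 : ∀ {x} → ¬ (x F.≈ F.0#) → ¬ (ι x ≈ 0#)
  ι-≉0 {x} x≉0 ιx≈0 with F.inverse x x≉0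
  ... | y , xy≈1 = 1≉0 (begin
    1#           ≈⟨ ι-1 ⟨
    ι F.1#       ≈⟨ ι-cong xy≈1 ⟨
    ι (x F.* y)  ≈⟨ ι-* x y ⟩
    ι x * ι y    ≈⟨ *-congʳ ιx≈0 ⟩
    0# * ι y     ≈⟨ zeroˡ _ ⟩
    0#           ∎)

  ι-injective : ∀ {x y} → ι x ≈ ι y → x F.≈ y
  ι-injective {x} {y} eq with x FP.≟ y
  ... | yes x≈y = x≈y
  ... | no  x≉y = contradiction (trans (ι-∸ x y) (x≈y⇒x-y≈0 eq)) (ι-≉0 (x≉y ∘ FP.x-y≈0⇒x≈y))

  ι-^ : ∀ x n → ι (x F.^ n) ≈ ι x ^ n
  ι-^ x zero    = ι-1
  ι-^ x (suc n) = trans (ι-* x (x F.^ n)) (*-congˡ (ι-^ x n))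

  conj-cong : ∀ {x y} → x ≈ y → conj x ≈ conj y
  conj-cong = ^-congˡ q

  conj-* : ∀ x y → conj (x * y) ≈ conj x * conj y
  conj-* x y = ^-distrib-* x y q

  conj-ι : ∀ x → conj (ι x) ≈ ι x
  conj-ι x = trans (sym (ι-^ x q)) (ι-cong (FP.fermat x))

  conj-0 : conj 0# ≈ 0#
  conj-0 = 0^n≈0 (FP.index F.0#)

  conj-1 : conj 1# ≈ 1#
  conj-1 = trans (conj-cong (sym ι-1)) (trans (conj-ι F.1#) ι-1)

  conj≈0 : ∀ {x} → conj x ≈ 0# → x ≈ 0#
  conj≈0 = x^n≈0⇒x≈0 q

  private
    ιs : Vector Carrier q
    ιs = ι ∘ FP.element

    ιs-injective : ∀ {i j} → ιs i ≈ ιs j → i ≡ j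
    ιs-injective = FP.element-injective ∘ ι-injective

    -- (x + y)ⁿ − xⁿ − yⁿ has degree less than n as a polynomial in x.
    additive-by-roots : ∀ {n} (r : Vector Carrier n) → Fin n → (∀ {i j} → r i ≈ r j → i ≡ j) →
                        ∀ y → (∀ i → (r i + y) ^ n ≈ r i ^ n + y ^ n) →
                        ∀ x → (x + y) ^ n ≈ x ^ n + y ^ n
    additive-by-roots {suc n} r _ r-inj y eq x = begin
      (x + y) ^ suc n
        ≈⟨ solve 3 (λ a b c → a ⊜ (a ⊖ b ⊕ ⊝ c) ⊕ (b ⊕ c)) ≡.refl ((x + y) ^ suc n Vec.∷ x ^ suc n Vec.∷ y ^ suc n Vec.∷ Vec.[]) ⟩
      ((x + y) ^ suc n - x ^ suc n - y ^ suc n) + (x ^ suc n + y ^ suc n)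
        ≈⟨ +-congʳ (factorByRoots poly r r-inj roots x) ⟩
      (1# - 1#) * product (λ i → x - r i) + (x ^ suc n + y ^ suc n)
        ≈⟨ +-congʳ (trans (*-congʳ (-‿inverseʳ 1#)) (zeroˡ _)) ⟩
      0# + (x ^ suc n + y ^ suc n)
        ≈⟨ +-identityˡ _ ⟩
      x ^ suc n + y ^ suc n ∎
      where
      poly : IsPolynomial (1# - 1#) (suc n) (λ x → (x + y) ^ suc n - x ^ suc n - y ^ suc n)
      poly = +-constant (- (y ^ suc n)) (∸-polynomial ([x+y]^-polynomial y (suc n)) (^-polynomial (suc n)))
      roots : ∀ i → (r i + y) ^ suc n - r i ^ suc n - y ^ suc n ≈ 0#
      roots i = trans (+-congʳ (+-congʳ (eq i)))
        (trans (+-congʳ (solve 2 (λ a b → (a ⊕ b) ⊖ a ⊜ b) ≡.refl (r i ^ suc n Vec.∷ y ^ suc n Vec.∷ Vec.[]))) (-‿inverseʳ _))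

  -- Two rounds of root counting. On ι(F) × ι(F) the identity holds because `conj` fixes ι(F).
  -- Counting roots in one variable extends it to E × ι(F), and after a swap, counting in the other
  -- variable extends it to E × E.
  conj-+ : ∀ x y → conj (x + y) ≈ conj x + conj y
  conj-+ x y = additive-by-roots ιs (FP.index F.0#) ιs-injective y
    (λ i → begin
      conj (ιs i + y)            ≈⟨ conj-cong (+-comm _ _) ⟩
      conj (y + ιs i)            ≈⟨ additive-by-roots ιs (FP.index F.0#) ιs-injective (ιs i) (λ j → on-ι (FP.element j) (FP.element i)) y ⟩
      conj y + conj (ιs i)       ≈⟨ +-comm _ _ ⟩
      conj (ιs i) + conj y       ∎) x
    where
    on-ι : ∀ x y → conj (ι x + ι y) ≈ conj (ι x) + conj (ι y)
    on-ι x y = begin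
      conj (ι x + ι y)          ≈⟨ conj-cong (ι-+ x y) ⟨
      conj (ι (x F.+ y))        ≈⟨ conj-ι _ ⟩
      ι (x F.+ y)               ≈⟨ ι-+ x y ⟩
      ι x + ι y                 ≈⟨ +-cong (conj-ι x) (conj-ι y) ⟨
      conj (ι x) + conj (ι y)   ∎

  conj-neg : ∀ x → conj (- x) ≈ - conj x
  conj-neg x = +-inverseˡ-unique _ _ (trans (sym (conj-+ (- x) x)) (trans (conj-cong (-‿inverseˡ x)) conj-0))

  private
    -- The bound excludes `n = 1`, where the leading terms cancel.
    x^n-x-polynomial : ∀ {n} → 2 ℕ.≤ n → IsPolynomial 1# n (λ x → x ^ n - x)
    x^n-x-polynomial {1}           (s≤s ())
    x^n-x-polynomial {suc (suc n)} _ = horner 0# (+-constant (- 1#) (^-polynomial (suc n))) λ x →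
      solve 2 (λ x y → x ⊗ (x ⊗ y) ⊖ x ⊜ Κ 0ℤ ⊕ x ⊗ (x ⊗ y ⊖ Κ 1ℤ)) ≡.refl (x Vec.∷ x ^ n Vec.∷ Vec.[])

  -- The `q` elements of ι(F) are roots of the monic `X^q − X`, so this polynomial is the product of
  -- the `X − ι a`; a fixed point of `conj` makes one factor vanish.
  conj-fixed : ∀ {z} → conj z ≈ z → ∃[ x ] z ≈ ι x
  conj-fixed {z} eq with product≈0 (λ i → z - ιs i) (trans (sym (trans
      (factorByRoots (x^n-x-polynomial FP.2≤q) ιs ιs-injective (λ i → x≈y⇒x-y≈0 (conj-ι (FP.element i))) z)
      (*-identityˡ _))) (x≈y⇒x-y≈0 eq))
  ... | i , z-ιsi≈0 = FP.element i , x-y≈0⇒x≈y z-ιsi≈0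

  module _ (e v : F.Carrier) (irreducible : Irreducible F e v) where
    private
      module Q = QuadraticQuotient F e v irreducible
      module F² = FiniteField Q.field²

      f : Carrier → Carrier
      f z = z * z + ι e * z - ι v

      -- Evaluates the representative `a + b X` at any point of `E`. Off the roots of `f` this is
      -- not multiplicative, and `value-θ*` records the defect as a multiple of `f z`.
      value : F².Carrier → Carrier → Carrier
      value (a , b) z = ι a + ι b * z

      θ : F².Carrier
      θ = F.0# , F.1#

      snd≈1 : proj₂ (θ F².^ 1) F.≈ F.1#
      snd≈1 = S.solve 1 (λ e → Κ 0ℤ ⊗ Κ 0ℤ ⊕ Κ 1ℤ ⊗ Κ 1ℤ S.⊖ e ⊗ (Κ 1ℤ ⊗ Κ 0ℤ) S.⊜ Κ 1ℤ) ≡.refl (e Vec.∷ Vec.[])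

      value-θ* : ∀ p z → z * value p z ≈ value (θ F².* p) z + f z * ι (proj₂ p)
      value-θ* (a , b) z = sym (begin
        ι (F.0# F.* a F.+ v F.* (F.1# F.* b)) + ι (F.0# F.* b F.+ F.1# F.* a F.- e F.* (F.1# F.* b)) * z + f z * ι b
          ≈⟨ +-congʳ (+-cong eq₀ (*-congʳ eq₁)) ⟩
        (ι v * ι b) + (ι a - ι e * ι b) * z + f z * ι b
          ≈⟨ solve 5 (λ a b e v z → v ⊗ b ⊕ (a ⊖ e ⊗ b) ⊗ z ⊕ (z ⊗ z ⊕ e ⊗ z ⊖ v) ⊗ b ⊜ z ⊗ (a ⊕ b ⊗ z)) ≡.refl (ι a Vec.∷ ι b Vec.∷ ι e Vec.∷ ι v Vec.∷ z Vec.∷ Vec.[]) ⟩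
        z * (ι a + ι b * z) ∎)
        where
        eq₀ : ι (F.0# F.* a F.+ v F.* (F.1# F.* b)) ≈ ι v * ι b
        eq₀ = trans (ι-cong (S.solve 3 (λ v a b → Κ 0ℤ ⊗ a ⊕ v ⊗ (Κ 1ℤ ⊗ b) S.⊜ v ⊗ b) ≡.refl (v Vec.∷ a Vec.∷ b Vec.∷ Vec.[]))) (ι-* v b)
        eq₁ : ι (F.0# F.* b F.+ F.1# F.* a F.- e F.* (F.1# F.* b)) ≈ ι a - ι e * ι b
        eq₁ = trans (ι-cong (S.solve 3 (λ e a b → Κ 0ℤ ⊗ b ⊕ Κ 1ℤ ⊗ a S.⊖ e ⊗ (Κ 1ℤ ⊗ b) S.⊜ a S.⊖ e ⊗ b) ≡.refl (e Vec.∷ a Vec.∷ b Vec.∷ Vec.[])))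
                (trans (ι-∸ _ _) (+-congˡ (-‿cong (ι-* e b))))

      value-θ : ∀ z → value (θ F².^ 1) z ≈ z
      value-θ z = begin
        value (θ F².^ 1) z
          ≈⟨ +-cong (ι-cong (S.solve 1 (λ v → Κ 0ℤ ⊗ Κ 1ℤ ⊕ v ⊗ (Κ 1ℤ ⊗ Κ 0ℤ) S.⊜ Κ 0ℤ) ≡.refl (v Vec.∷ Vec.[])))
                    (*-congʳ (ι-cong snd≈1)) ⟩
        ι F.0# + ι F.1# * z   ≈⟨ +-cong ι-0 (*-congʳ ι-1) ⟩
        0# + 1# * z           ≈⟨ trans (+-identityˡ _) (*-identityˡ z) ⟩
        z                     ∎

      divide-step : ∀ p g z → z * (f z * g + value p z) ≈ f z * (z * g + ι (proj₂ p)) + value (θ F².* p) z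
      divide-step p g z = begin
        z * (f z * g + value p z)
          ≈⟨ solve 4 (λ z f g w → z ⊗ (f ⊗ g ⊕ w) ⊜ f ⊗ (z ⊗ g) ⊕ z ⊗ w) ≡.refl (z Vec.∷ f z Vec.∷ g Vec.∷ value p z Vec.∷ Vec.[]) ⟩
        f z * (z * g) + z * value p z
          ≈⟨ +-congˡ (value-θ* p z) ⟩
        f z * (z * g) + (value (θ F².* p) z + f z * ι (proj₂ p))
          ≈⟨ solve 4 (λ a f w b → f ⊗ a ⊕ (w ⊕ f ⊗ b) ⊜ f ⊗ (a ⊕ b) ⊕ w) ≡.refl (z * g Vec.∷ f z Vec.∷ value (θ F².* p) z Vec.∷ ι (proj₂ p) Vec.∷ Vec.[]) ⟩
        f z * (z * g + ι (proj₂ p)) + value (θ F².* p) z ∎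

      -- Long division of X^(2+n) by `f`, with remainder read off from the power of `θ` in the
      -- quotient field. Exponent 2 is the first with a nonzero quotient, which makes the quotient
      -- monic of degree exactly `n`.
      divide : ∀ n → ∃[ g ] IsPolynomial 1# n g × (∀ z → z ^ (2 ℕ.+ n) ≈ f z * g z + value (θ F².^ (2 ℕ.+ n)) z)
      -- One step from `X = f · 0 + X`: the new quotient is the coefficient of `X` in `θ`, namely 1.
      divide zero = (λ z → z * 0# + ι (proj₂ (θ F².^ 1))) , constant (λ z → trans (+-cong (zeroʳ z) (trans (ι-cong snd≈1) ι-1)) (+-identityˡ 1#)) , λ z → begin
        z * (z * 1#)                            ≈⟨ *-congˡ (trans (*-identityʳ z) (sym (value-θ z))) ⟩
        z * value (θ F².^ 1) z                  ≈⟨ *-congˡ (trans (+-congʳ (zeroʳ (f z))) (+-identityˡ _)) ⟨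
        z * (f z * 0# + value (θ F².^ 1) z)     ≈⟨ divide-step _ 0# z ⟩
        f z * (z * 0# + ι (proj₂ (θ F².^ 1))) + value (θ F².^ 2) z ∎
      divide (suc n) with divide n
      ... | g , pg , eq = (λ z → z * g z + ι (proj₂ (θ F².^ (2 ℕ.+ n)))) , +-constant _ (x*-polynomial pg)
                        , λ z → trans (*-congˡ (eq z)) (divide-step _ (g z) z)

      divide-fermat : ∀ n → 2 ℕ.+ n ≡ q ℕ.^ 2 →
                      ∃[ g ] IsPolynomial 1# n g × (∀ z → f z * g z ≈ 0#)
      divide-fermat n 2+n≡q² with divide n
      ... | g , pg , eq = g , pg , λ z → +-identityˡ-unique _ _ (begin
        f z * g z + z                              ≈⟨ +-congˡ (trans (+-cong ι-0 (trans (*-congʳ ι-1) (*-identityˡ z))) (+-identityˡ z)) ⟨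
        f z * g z + value θ z                      ≈⟨ +-congˡ (+-cong (ι-cong (proj₁ (θ^ n 2+n≡q²))) (*-congʳ (ι-cong (proj₂ (θ^ n 2+n≡q²))))) ⟨
        f z * g z + value (θ F².^ (2 ℕ.+ n)) z     ≈⟨ eq z ⟨
        z ^ (2 ℕ.+ n)                              ≡⟨ ≡.cong (z ^_) 2+n≡q² ⟩
        z ^ (q ℕ.^ 2)                              ≈⟨ fermat z ⟩
        z                                          ∎)
        where
        θ^ : ∀ n → 2 ℕ.+ n ≡ q ℕ.^ 2 → θ F².^ (2 ℕ.+ n) F².≈ θ
        θ^ n eq = F².trans (F².reflexive (≡.cong (θ F².^_) eq)) (FiniteFieldProperties.fermat Q.field² θ)

    -- `E` can be searched. If `f` had no root, then `f z * g z ≈ 0#` would make the monic `g`, of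
    -- degree `q² − 2`, vanish on all `q²` elements of `E`.
    root : ∃[ z ] f z ≈ 0#
    root with Finₚ.any? (λ i → f (element i) ≟ 0#)
    ... | yes (i , eq) = element i , eq
    -- Here `2≤q` is the bound for the field `E`, that is `2 ≤ q ^ 2`.
    ... | no  no-root  with divide-fermat (q ℕ.^ 2 ℕ.∸ 2) (ℕₚ.m+[n∸m]≡n 2≤q)
    ...   | g , pg , fg≈0 = contradiction
      (λ x → x*y≈0⇒y≈0 (λ fx≈0 → no-root (index x , trans (f-cong (element-index x)) fx≈0)) (fg≈0 x))
      (monic-nonvanishing (ℕₚ.≤-trans (ℕₚ.n≤1+n _) (ℕₚ.≤-reflexive (ℕₚ.m+[n∸m]≡n 2≤q))) pg)
      where
      f-cong : ∀ {x y} → x ≈ y → f x ≈ f y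
      f-cong x≈y = +-congʳ (+-cong (*-cong x≈y x≈y) (*-congˡ x≈y))

    -- Applying `conj` to the equation of `z` shows that `conj z` is a root too. It differs from
    -- `z`, since a fixed `z` would lie in ι(F) and contradict irreducibility; subtracting the two
    -- equations and cancelling `z - conj z` gives the sum, and the equation then gives the product.
    conjugateRoots : ConjugateRoots X e v
    conjugateRoots with root
    ... | z , fz≈0 = record { z = z ; z+z̄ = sum≈ ; zz̄ = product≈ ; z≉z̄ = z≉z̄ }
      where
      z² : z * z + ι e * z ≈ ι v
      z² = x-y≈0⇒x≈y fz≈0
      z̄² : conj z * conj z + ι e * conj z ≈ ι v
      z̄² = begin
        conj z * conj z + ι e * conj z          ≈⟨ +-cong (conj-* z z) (trans (conj-* (ι e) z) (*-congʳ (conj-ι e))) ⟨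
        conj (z * z) + conj (ι e * z)           ≈⟨ conj-+ _ _ ⟨
        conj (z * z + ι e * z)                  ≈⟨ conj-cong z² ⟩
        conj (ι v)                              ≈⟨ conj-ι v ⟩
        ι v                                     ∎
      z≉z̄ : ¬ (z ≈ conj z)
      z≉z̄ z≈z̄ with conj-fixed (sym z≈z̄)
      ... | x , z≈ιx = irreducible x (ι-injective (begin
        ι (x F.* x F.+ e F.* x F.- v)        ≈⟨ trans (ι-∸ _ _) (+-congʳ (trans (ι-+ _ _) (+-cong (ι-* x x) (ι-* e x)))) ⟩
        ι x * ι x + ι e * ι x - ι v          ≈⟨ +-congʳ (+-cong (*-cong z≈ιx z≈ιx) (*-congˡ z≈ιx)) ⟨
        f z                                  ≈⟨ fz≈0 ⟩
        0#                                   ≈⟨ ι-0 ⟨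
        ι F.0#                               ∎))
      sum≈ : z + conj z ≈ - ι e
      sum≈ = +-inverseˡ-unique _ _ (x*y≈0⇒y≈0 (λ eq → z≉z̄ (x-y≈0⇒x≈y eq)) (begin
        (z - conj z) * (z + conj z + ι e)
          ≈⟨ solve 3 (λ z w e → (z ⊖ w) ⊗ (z ⊕ w ⊕ e) ⊜ (z ⊗ z ⊕ e ⊗ z) ⊖ (w ⊗ w ⊕ e ⊗ w)) ≡.refl (z Vec.∷ conj z Vec.∷ ι e Vec.∷ Vec.[]) ⟩
        (z * z + ι e * z) - (conj z * conj z + ι e * conj z)   ≈⟨ x≈y⇒x-y≈0 (trans z² (sym z̄²)) ⟩
        0# ∎))
      product≈ : z * conj z ≈ - ι v
      product≈ = begin
        z * conj z                               ≈⟨ solve 3 (λ z w e → z ⊗ w ⊜ z ⊗ (z ⊕ w) ⊕ e ⊗ z ⊖ (z ⊗ z ⊕ e ⊗ z)) ≡.refl (z Vec.∷ conj z Vec.∷ ι e Vec.∷ Vec.[]) ⟩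
        z * (z + conj z) + ι e * z - (z * z + ι e * z) ≈⟨ +-cong (+-congʳ (*-congˡ sum≈)) (-‿cong z²) ⟩
        z * - ι e + ι e * z - ι v                ≈⟨ solve 3 (λ z e v → z ⊗ ⊝ e ⊕ e ⊗ z ⊖ v ⊜ ⊝ v) ≡.refl (z Vec.∷ ι e Vec.∷ ι v Vec.∷ Vec.[]) ⟩
        - ι v                                    ∎

-- Ternary quadratic forms and linear substitution.

-- Stated over a raw ring, so that the operations can be applied both to field
-- elements and to the expressions of the ring solver. Over a field, product-form,
-- congruence and disc unfold to _⊗_, _∙_ and discriminant from Defs.
module FormOperations {c ℓ} (R : RawRing c ℓ) where
  open RawRing R

  quadratic : Vector Carrier 6 → Vector Carrier 3 → Carrier
  quadratic a x = a 0F * (x 0F * x 0F) + a 1F * (x 0F * x 1F) + a 2F * (x 0F * x 2F)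
                + a 3F * (x 1F * x 1F) + a 4F * (x 1F * x 2F) + a 5F * (x 2F * x 2F)

  -- `Q(x + y) − Q(x) − Q(y)` for the form `Q` with coefficients `a`. On two columns of a matrix it
  -- is the mixed coefficient of the substituted form, in every characteristic.
  polar : Vector Carrier 6 → Vector Carrier 3 → Vector Carrier 3 → Carrier
  polar a x y = a 0F * (x 0F * y 0F + y 0F * x 0F) + a 1F * (x 0F * y 1F + y 0F * x 1F)
              + a 2F * (x 0F * y 2F + y 0F * x 2F) + a 3F * (x 1F * y 1F + y 1F * x 1F)
              + a 4F * (x 1F * y 2F + y 1F * x 2F) + a 5F * (x 2F * y 2F + y 2F * x 2F)

  column : Vector (Vector Carrier 3) 3 → Fin 3 → Vector Carrier 3
  column A j i = A i j

  -- The coefficients of the quadratic form x ↦ a(A x).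
  _⋆_ : Vector Carrier 6 → Vector (Vector Carrier 3) 3 → Vector Carrier 6
  a ⋆ A = quadratic a (column A 0F)
        ∷ polar a (column A 0F) (column A 1F)
        ∷ polar a (column A 0F) (column A 2F)
        ∷ quadratic a (column A 1F)
        ∷ polar a (column A 1F) (column A 2F)
        ∷ quadratic a (column A 2F)
        ∷ []

  -- Bracketed as `sum` over `Fin 3` unfolds, final zero included, so that over a field `_*₃_`
  -- agrees with `_*ₘ_` definitionally. The pairing `⟨_,_⟩` follows `sum` over `Fin 6` in the same
  -- way.
  ∑₃ : Vector Carrier 3 → Carrier
  ∑₃ x = x 0F + (x 1F + (x 2F + 0#))

  _⋆ₗ_ : Vector Carrier 3 → Vector (Vector Carrier 3) 3 → Vector Carrier 3
  (l ⋆ₗ A) j = ∑₃ (λ i → l i * A i j)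

  _*₃_ : (A B : Vector (Vector Carrier 3) 3) → Vector (Vector Carrier 3) 3
  (A *₃ B) i j = ∑₃ (λ k → A i k * B k j)

  product-form : Vector Carrier 3 → Vector Carrier 3 → Vector Carrier 6
  product-form l m = l 0F * m 0F
        ∷ l 0F * m 1F + l 1F * m 0F
        ∷ l 0F * m 2F + l 2F * m 0F
        ∷ l 1F * m 1F
        ∷ l 1F * m 2F + l 2F * m 1F
        ∷ l 2F * m 2F
        ∷ []

  symmetric : Vector Carrier 6 → Vector (Vector Carrier 3) 3
  symmetric y = (y 0F ∷ y 1F ∷ y 2F ∷ [])
              ∷ (y 1F ∷ y 3F ∷ y 4F ∷ [])
              ∷ (y 2F ∷ y 4F ∷ y 5F ∷ [])
              ∷ []

  congruence : Vector (Vector Carrier 3) 3 → Vector Carrier 6 → Vector Carrier 6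
  congruence A y = M 0F 0F ∷ M 0F 1F ∷ M 0F 2F ∷ M 1F 1F ∷ M 1F 2F ∷ M 2F 2F ∷ []
    where
    M : Vector (Vector Carrier 3) 3
    M = (A *₃ symmetric y) *₃ (λ i j → A j i)

  ⟨_,_⟩ : Vector Carrier 6 → Vector Carrier 6 → Carrier
  ⟨ a , y ⟩ = a 0F * y 0F + (a 1F * y 1F + (a 2F * y 2F + (a 3F * y 3F + (a 4F * y 4F + (a 5F * y 5F + 0#)))))

  determinant : Vector (Vector Carrier 3) 3 → Carrier
  determinant A = A 0F 0F * (A 1F 1F * A 2F 2F + - (A 1F 2F * A 2F 1F))
                + - (A 0F 1F * (A 1F 0F * A 2F 2F + - (A 1F 2F * A 2F 0F)))
                + A 0F 2F * (A 1F 0F * A 2F 1F + - (A 1F 1F * A 2F 0F))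

  disc : Vector Carrier 6 → Carrier
  disc a = (t + (t + (t + (t + 0#)))) + a 1F * a 2F * a 4F
         + - (a 0F * (a 4F * a 4F)) + - (a 3F * (a 2F * a 2F)) + - (a 5F * (a 1F * a 1F))
    where
    t : Carrier
    t = a 0F * a 3F * a 5F

module Forms {q c ℓ} (F : FiniteField q c ℓ) where
  open FiniteField F hiding (zero)
  open FiniteFieldProperties F hiding (_⊜_; _⊖_)
  open Projective F hiding (_⊗_)
  open FormOperations (CommutativeRing.rawRing commutativeRing) public
  open SetoidReasoning setoid

  private
    exprRing : ℕ → RawRing _ _
    exprRing n = record
      { Carrier = Expr ℤ n ; _≈_ = _≡_ ; _+_ = _⊕_ ; _*_ = _⊗_ ; -_ = ⊝_ ; 0# = Κ 0ℤ ; 1# = Κ 1ℤ }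

    module Ex {n} = FormOperations (exprRing n)

    entries : Vector (Vector Carrier 3) 3 → Vec Carrier 9
    entries A = Vec.tabulate (A 0F) Vec.++ Vec.tabulate (A 1F) Vec.++ Vec.tabulate (A 2F)

    vec : ∀ {n k} → (Fin k → Fin n) → Vector (Expr ℤ n) k
    vec f i = Ι (f i)

    mat : ∀ {n} → (Fin 9 → Fin n) → Vector (Vector (Expr ℤ n) 3) 3
    mat f i j = Ι (f (combine i j))

  -- Pairing a form with the matrix x xᵀ evaluates it at x, and congruence by `A` turns x xᵀ into
  -- (Ax)(Ax)ᵀ. The action on points is therefore adjoint to substitution into forms.
  ⟨⟩-adjoint : ∀ a A y → ⟨ a , congruence A y ⟩ ≈ ⟨ a ⋆ A , y ⟩
  ⟨⟩-adjoint a A y = prove {21} Ex.⟨ a′ , Ex.congruence A′ y′ ⟩ Ex.⟨ a′ Ex.⋆ A′ , y′ ⟩ ≡.refl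
                        (Vec.tabulate a Vec.++ entries A Vec.++ Vec.tabulate y)
    where
    a′ = vec (_↑ˡ 15)
    A′ = mat (λ i → 6 ↑ʳ (i ↑ˡ 6))
    y′ = vec (15 ↑ʳ_)

  -- The index is split into its six values because normal forms compute only for concrete
  -- expressions; the same pattern recurs below.
  ⋆-⋆ : ∀ a A C → ∀ i → ((a ⋆ A) ⋆ C) i ≈ (a ⋆ (A *₃ C)) i
  ⋆-⋆ a A C = λ
    { 0F → go 0F ≡.refl
    ; 1F → go 1F ≡.refl
    ; 2F → go 2F ≡.refl
    ; 3F → go 3F ≡.refl
    ; 4F → go 4F ≡.refl
    ; 5F → go 5F ≡.refl
    }
    where
    a′ = vec (_↑ˡ 18)
    A′ = mat (λ i → 6 ↑ʳ (i ↑ˡ 9))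
    C′ = mat (15 ↑ʳ_)
    go = λ i eq → prove {24} (((a′ Ex.⋆ A′) Ex.⋆ C′) i) ((a′ Ex.⋆ (A′ Ex.*₃ C′)) i) eq
                    (Vec.tabulate a Vec.++ entries A Vec.++ entries C)

  quadratic-cong : ∀ {a b x y} → (∀ i → a i ≈ b i) → (∀ i → x i ≈ y i) → quadratic a x ≈ quadratic b y
  quadratic-cong a≈b x≈y =
    +-cong (+-cong (+-cong (+-cong (+-cong (term 0F 0F 0F) (term 1F 0F 1F)) (term 2F 0F 2F)) (term 3F 1F 1F)) (term 4F 1F 2F)) (term 5F 2F 2F)
    where term = λ i j k → *-cong (a≈b i) (*-cong (x≈y j) (x≈y k))

  polar-cong : ∀ {a b x y z w} → (∀ i → a i ≈ b i) → (∀ i → x i ≈ y i) → (∀ i → z i ≈ w i) →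
               polar a x z ≈ polar b y w
  polar-cong a≈b x≈y z≈w =
    +-cong (+-cong (+-cong (+-cong (+-cong (term 0F 0F 0F) (term 1F 0F 1F)) (term 2F 0F 2F)) (term 3F 1F 1F)) (term 4F 1F 2F)) (term 5F 2F 2F)
    where term = λ i j k → *-cong (a≈b i) (+-cong (*-cong (x≈y j) (z≈w k)) (*-cong (z≈w j) (x≈y k)))

  ⋆-cong : ∀ {a b A B} → (∀ i → a i ≈ b i) → (∀ i j → A i j ≈ B i j) → ∀ i → (a ⋆ A) i ≈ (b ⋆ B) i
  ⋆-cong a≈b A≈B = λ
    { 0F → quadratic-cong a≈b (col 0F)
    ; 1F → polar-cong a≈b (col 0F) (col 1F)
    ; 2F → polar-cong a≈b (col 0F) (col 2F)
    ; 3F → quadratic-cong a≈b (col 1F)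
    ; 4F → polar-cong a≈b (col 1F) (col 2F)
    ; 5F → quadratic-cong a≈b (col 2F)
    }
    where col = λ j i → A≈B i j

  ⋆-identity : ∀ a i → (a ⋆ Iₘ) i ≈ a i
  ⋆-identity a = λ
    { 0F → go 0F ≡.refl
    ; 1F → go 1F ≡.refl
    ; 2F → go 2F ≡.refl
    ; 3F → go 3F ≡.refl
    ; 4F → go 4F ≡.refl
    ; 5F → go 5F ≡.refl
    }
    where
    a′ = vec {6} (λ i → i)
    go = λ i eq → prove {6} ((a′ Ex.⋆ (λ i j → if does (i Finₚ.≟ j) then Κ 1ℤ else Κ 0ℤ)) i) (a′ i) eq (Vec.tabulate a)

  ⋆-inverse : ∀ A C → (∀ i j → (A *₃ C) i j ≈ Iₘ i j) → ∀ a i → ((a ⋆ A) ⋆ C) i ≈ a i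
  ⋆-inverse A C AC≈I a i = begin
    ((a ⋆ A) ⋆ C) i     ≈⟨ ⋆-⋆ a A C i ⟩
    (a ⋆ (A *₃ C)) i    ≈⟨ ⋆-cong {a = a} (λ _ → refl) AC≈I i ⟩
    (a ⋆ Iₘ) i          ≈⟨ ⋆-identity a i ⟩
    a i                 ∎

  ⋆-scale : ∀ k a A i → ((λ i → k * a i) ⋆ A) i ≈ k * (a ⋆ A) i
  ⋆-scale k a A = λ
    { 0F → go 0F ≡.refl
    ; 1F → go 1F ≡.refl
    ; 2F → go 2F ≡.refl
    ; 3F → go 3F ≡.refl
    ; 4F → go 4F ≡.refl
    ; 5F → go 5F ≡.refl
    }
    where
    k′ = Ι 0F
    a′ = vec (λ i → 1 ↑ʳ (i ↑ˡ 9))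
    A′ = mat (7 ↑ʳ_)
    go = λ i eq → prove {16} (((λ i → k′ ⊗ a′ i) Ex.⋆ A′) i) (k′ ⊗ (a′ Ex.⋆ A′) i) eq
                    (k Vec.∷ Vec.tabulate a Vec.++ entries A)

  product-form-⋆ : ∀ l m A i → (product-form l m ⋆ A) i ≈ product-form (l ⋆ₗ A) (m ⋆ₗ A) i
  product-form-⋆ l m A = λ
    { 0F → go 0F ≡.refl
    ; 1F → go 1F ≡.refl
    ; 2F → go 2F ≡.refl
    ; 3F → go 3F ≡.refl
    ; 4F → go 4F ≡.refl
    ; 5F → go 5F ≡.refl
    }
    where
    l′ = vec (λ i → i ↑ˡ 12)
    m′ = vec (λ i → 3 ↑ʳ (i ↑ˡ 9))
    A′ = mat (6 ↑ʳ_)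
    go = λ i eq → prove {15} ((Ex.product-form l′ m′ Ex.⋆ A′) i) (Ex.product-form (l′ Ex.⋆ₗ A′) (m′ Ex.⋆ₗ A′) i) eq
                    (Vec.tabulate l Vec.++ Vec.tabulate m Vec.++ entries A)

  product-form-cong : ∀ {l l′ m m′} → (∀ i → l i ≈ l′ i) → (∀ i → m i ≈ m′ i) →
                      ∀ i → product-form l m i ≈ product-form l′ m′ i
  product-form-cong l≈ m≈ = λ
    { 0F → *-cong (l≈ 0F) (m≈ 0F)
    ; 1F → +-cong (*-cong (l≈ 0F) (m≈ 1F)) (*-cong (l≈ 1F) (m≈ 0F))
    ; 2F → +-cong (*-cong (l≈ 0F) (m≈ 2F)) (*-cong (l≈ 2F) (m≈ 0F))
    ; 3F → *-cong (l≈ 1F) (m≈ 1F)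
    ; 4F → +-cong (*-cong (l≈ 1F) (m≈ 2F)) (*-cong (l≈ 2F) (m≈ 1F))
    ; 5F → *-cong (l≈ 2F) (m≈ 2F)
    }

  product-form-scaleˡ : ∀ k l m i → product-form (λ j → k * l j) m i ≈ k * product-form l m i
  product-form-scaleˡ k l m = λ
    { 0F → go 0F ≡.refl
    ; 1F → go 1F ≡.refl
    ; 2F → go 2F ≡.refl
    ; 3F → go 3F ≡.refl
    ; 4F → go 4F ≡.refl
    ; 5F → go 5F ≡.refl
    }
    where
    k′ = Ι 0F
    l′ = vec (λ i → 1 ↑ʳ (i ↑ˡ 3))
    m′ = vec (4 ↑ʳ_)
    go = λ i eq → prove {7} (Ex.product-form (λ j → k′ ⊗ l′ j) m′ i) (k′ ⊗ Ex.product-form l′ m′ i) eq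
                    (k Vec.∷ Vec.tabulate l Vec.++ Vec.tabulate m)

  ⋆ₗ-cong : ∀ {l m} A → (∀ i → l i ≈ m i) → ∀ j → (l ⋆ₗ A) j ≈ (m ⋆ₗ A) j
  ⋆ₗ-cong A l≈m j = +-cong (*-congʳ (l≈m 0F)) (+-cong (*-congʳ (l≈m 1F)) (+-congʳ (*-congʳ (l≈m 2F))))

  ⋆ₗ-scale : ∀ k l A j → ((λ i → k * l i) ⋆ₗ A) j ≈ k * (l ⋆ₗ A) j
  ⋆ₗ-scale k l A j = prove {7} ((λ i → k′ ⊗ l′ i) Ex.⋆ₗ (λ i _ → A′ i) $ 0F) (k′ ⊗ (l′ Ex.⋆ₗ (λ i _ → A′ i)) 0F) ≡.refl
                       (k Vec.∷ Vec.tabulate l Vec.++ Vec.tabulate (λ i → A i j))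
    where
    k′ = Ι 0F
    l′ = vec (λ i → 1 ↑ʳ (i ↑ˡ 3))
    A′ = vec (4 ↑ʳ_)

  ⋆ₗ-inverse : ∀ A C → (∀ i j → (A *₃ C) i j ≈ Iₘ i j) → ∀ l j → ((l ⋆ₗ A) ⋆ₗ C) j ≈ l j
  ⋆ₗ-inverse A C AC≈I l j = begin
    ((l ⋆ₗ A) ⋆ₗ C) j    ≈⟨ prove {15} ((l′ Ex.⋆ₗ A′) Ex.⋆ₗ (λ i _ → C′ i) $ 0F) ((l′ Ex.⋆ₗ (A′ Ex.*₃ (λ i _ → C′ i))) 0F) ≡.refl
                            (Vec.tabulate l Vec.++ entries A Vec.++ Vec.tabulate (λ i → C i j)) ⟩
    (l ⋆ₗ (A *₃ C)) j    ≈⟨ +-cong (*-congˡ (AC≈I 0F j)) (+-cong (*-congˡ (AC≈I 1F j)) (+-congʳ (*-congˡ (AC≈I 2F j)))) ⟩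
    (l ⋆ₗ Iₘ) j          ≈⟨ identity j ⟩
    l j                  ∎
    where
    l′ = vec (_↑ˡ 12)
    A′ = mat (λ i → 3 ↑ʳ (i ↑ˡ 3))
    C′ = vec (12 ↑ʳ_)
    I′ : Vector (Vector (Expr ℤ 3) 3) 3
    I′ i j = if does (i Finₚ.≟ j) then Κ 1ℤ else Κ 0ℤ
    identity : ∀ j → (l ⋆ₗ Iₘ) j ≈ l j
    identity = λ
      { 0F → prove {3} ((vec (λ i → i) Ex.⋆ₗ I′) 0F) (Ι 0F) ≡.refl (Vec.tabulate l)
      ; 1F → prove {3} ((vec (λ i → i) Ex.⋆ₗ I′) 1F) (Ι 1F) ≡.refl (Vec.tabulate l)
      ; 2F → prove {3} ((vec (λ i → i) Ex.⋆ₗ I′) 2F) (Ι 2F) ≡.refl (Vec.tabulate l)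
      }

  ∼-⋆ₗ : ∀ {l m} A → l ∼ m → (l ⋆ₗ A) ∼ (m ⋆ₗ A)
  ∼-⋆ₗ {l} {m} A (k , k≉0 , eq) = k , k≉0 , λ j → trans (⋆ₗ-cong A eq j) (⋆ₗ-scale k m A j)

  ∼-⋆ₗ⁻¹ : ∀ {l m} A C → (∀ i j → (A *₃ C) i j ≈ Iₘ i j) → (l ⋆ₗ A) ∼ (m ⋆ₗ A) → l ∼ m
  ∼-⋆ₗ⁻¹ {l} {m} A C AC≈I lA∼mA with ∼-⋆ₗ C lA∼mA
  ... | k , k≉0 , eq = k , k≉0 , λ j →
    trans (sym (⋆ₗ-inverse A C AC≈I l j)) (trans (eq j) (*-congˡ (⋆ₗ-inverse A C AC≈I m j)))

  disc-cong : ∀ {a b} → (∀ i → a i ≈ b i) → disc a ≈ disc b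
  disc-cong eq = +-cong (+-cong (+-cong (+-cong
    (+-cong t (+-cong t (+-cong t (+-cong t refl)))) (*-cong (*-cong (eq 1F) (eq 2F)) (eq 4F)))
    (s 0F 4F)) (s 3F 2F)) (s 5F 1F)
    where
    t = *-cong (*-cong (eq 0F) (eq 3F)) (eq 5F)
    s = λ i j → -‿cong (*-cong (eq i) (*-cong (eq j) (eq j)))

  -- Over the integers `disc` is half the determinant of the Gram matrix of `polar`, which explains
  -- the squared determinant. As an identity with integer coefficients it also covers characteristic
  -- 2.
  disc-⋆ : ∀ a A → disc (a ⋆ A) ≈ determinant A * determinant A * disc a
  disc-⋆ a A = prove {15} (Ex.disc (a′ Ex.⋆ A′)) (Ex.determinant A′ ⊗ Ex.determinant A′ ⊗ Ex.disc a′) ≡.refl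
                 (Vec.tabulate a Vec.++ entries A)
    where
    a′ = vec (_↑ˡ 9)
    A′ = mat (6 ↑ʳ_)

  disc-scale : ∀ k a → disc (λ i → k * a i) ≈ k * k * k * disc a
  disc-scale k a = prove {7} (Ex.disc (λ i → Ι 0F ⊗ a′ i)) (Ι 0F ⊗ Ι 0F ⊗ Ι 0F ⊗ Ex.disc a′) ≡.refl
                     (k Vec.∷ Vec.tabulate a)
    where a′ = vec (1 ↑ʳ_)

  disc-product-form : ∀ l m → disc (product-form l m) ≈ 0#
  disc-product-form l m = prove {6} (Ex.disc (Ex.product-form (vec (_↑ˡ 3)) (vec (3 ↑ʳ_)))) (Κ 0ℤ) ≡.refl
                            (Vec.tabulate l Vec.++ Vec.tabulate m)

  ⋆-zero : ∀ {a} A → (∀ i → a i ≈ 0#) → ∀ i → (a ⋆ A) i ≈ 0#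
  ⋆-zero {a} A a≈0 i = begin
    (a ⋆ A) i                 ≈⟨ ⋆-cong {B = A} (λ j → trans (a≈0 j) (sym (zeroˡ (a j)))) (λ _ _ → refl) i ⟩
    ((λ j → 0# * a j) ⋆ A) i  ≈⟨ ⋆-scale 0# a A i ⟩
    0# * (a ⋆ A) i            ≈⟨ zeroˡ _ ⟩
    0#                        ∎

  ∼-⋆ : ∀ {a b} A → a ∼ b → (a ⋆ A) ∼ (b ⋆ A)
  ∼-⋆ {a} {b} A (k , k≉0 , eq) = k , k≉0 , λ i →
    trans (⋆-cong {B = A} eq (λ _ _ → refl) i) (⋆-scale k b A i)

  ≈⇒∼ : ∀ {n} {a b : Vector Carrier n} → (∀ i → a i ≈ b i) → a ∼ b
  ≈⇒∼ eq = 1# , 1≉0 , λ i → trans (eq i) (sym (*-identityˡ _))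

  ⟨⟩-congʳ : ∀ a {x y} → (∀ i → x i ≈ y i) → ⟨ a , x ⟩ ≈ ⟨ a , y ⟩
  ⟨⟩-congʳ a eq = +-cong (t 0F) (+-cong (t 1F) (+-cong (t 2F) (+-cong (t 3F) (+-cong (t 4F) (+-congʳ (t 5F))))))
    where t = λ i → *-congˡ {a i} (eq i)

  ⟨⟩-congˡ : ∀ {a b} y → (∀ i → a i ≈ b i) → ⟨ a , y ⟩ ≈ ⟨ b , y ⟩
  ⟨⟩-congˡ y eq = +-cong (t 0F) (+-cong (t 1F) (+-cong (t 2F) (+-cong (t 3F) (+-cong (t 4F) (+-congʳ (t 5F))))))
    where t = λ i → *-congʳ {y i} (eq i)

  ⟨⟩-scale : ∀ a k y → ⟨ a , (λ i → k * y i) ⟩ ≈ k * ⟨ a , y ⟩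
  ⟨⟩-scale a k y = prove {13} (Ex.⟨ a′ , (λ i → k′ ⊗ y′ i) ⟩) (k′ ⊗ Ex.⟨ a′ , y′ ⟩) ≡.refl
                     (k Vec.∷ Vec.tabulate a Vec.++ Vec.tabulate y)
    where
    k′ = Ι 0F
    a′ = vec (λ i → 1 ↑ʳ (i ↑ˡ 6))
    y′ = vec (7 ↑ʳ_)

  disc-⋆≈0 : ∀ a A → disc a ≈ 0# → disc (a ⋆ A) ≈ 0#
  disc-⋆≈0 a A eq = trans (disc-⋆ a A) (trans (*-congˡ eq) (zeroʳ _))

  -- Coefficients 0, 1 and 3 are those free of X₂. Their vanishing says that the two factors
  -- restricted to X₂ = 0 have product zero, and polynomials over a field have no zero divisors.
  product-form-factor : ∀ l m → product-form l m 0F ≈ 0# → product-form l m 1F ≈ 0# → product-form l m 3F ≈ 0# →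
                        (l 0F ≈ 0# × l 1F ≈ 0#) ⊎ (m 0F ≈ 0# × m 1F ≈ 0#)
  product-form-factor l m l₀m₀≈0 eq l₁m₁≈0 with l 0F ≟ 0#
  ... | no l₀≉0 = inj₂ (m₀≈0 , x*y≈0⇒y≈0 l₀≉0 (begin
      l 0F * m 1F                 ≈⟨ +-identityʳ _ ⟨
      l 0F * m 1F + 0#            ≈⟨ +-congˡ (trans (*-congˡ m₀≈0) (zeroʳ _)) ⟨
      l 0F * m 1F + l 1F * m 0F   ≈⟨ eq ⟩
      0#                          ∎))
    where
    m₀≈0 : m 0F ≈ 0#
    m₀≈0 = x*y≈0⇒y≈0 l₀≉0 l₀m₀≈0
  ... | yes l₀≈0 with l 1F ≟ 0#
  ...   | yes l₁≈0 = inj₁ (l₀≈0 , l₁≈0)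
  ...   | no  l₁≉0 = inj₂ (x*y≈0⇒y≈0 l₁≉0 (begin
      l 1F * m 0F                 ≈⟨ +-identityˡ _ ⟨
      0# + l 1F * m 0F            ≈⟨ +-congʳ (trans (*-congʳ l₀≈0) (zeroˡ _)) ⟨
      l 0F * m 1F + l 1F * m 0F   ≈⟨ eq ⟩
      0#                          ∎) , x*y≈0⇒y≈0 l₁≉0 l₁m₁≈0)

  only-X₂-∼ : ∀ {l m : Vector Carrier 3} → l 0F ≈ 0# → l 1F ≈ 0# → m 0F ≈ 0# → m 1F ≈ 0# →
              ¬ (l 2F * m 2F ≈ 0#) → l ∼ m
  only-X₂-∼ {l} {m} l₀ l₁ m₀ m₁ l₂m₂≉0 with inverse (m 2F) (λ m₂≈0 → l₂m₂≉0 (trans (*-congˡ m₂≈0) (zeroʳ _)))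
  ... | w , m₂w≈1 = l 2F * w
    , *-nonZero (λ l₂≈0 → l₂m₂≉0 (trans (*-congʳ l₂≈0) (zeroˡ _)))
                (λ w≈0 → 1≉0 (trans (sym m₂w≈1) (trans (*-congˡ w≈0) (zeroʳ _))))
    , λ { 0F → trans l₀ (sym (trans (*-congˡ m₀) (zeroʳ _)))
        ; 1F → trans l₁ (sym (trans (*-congˡ m₁) (zeroʳ _)))
        ; 2F → sym (begin
            l 2F * w * m 2F     ≈⟨ *-assoc _ _ _ ⟩
            l 2F * (w * m 2F)   ≈⟨ *-congˡ (trans (*-comm _ _) m₂w≈1) ⟩
            l 2F * 1#           ≈⟨ *-identityʳ _ ⟩
            l 2F                ∎) }

  -- Restricted to X₂ = 0 one factor vanishes, so it is a nonzero multiple of X₂; the coefficients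
  -- of X₀X₂ and X₁X₂ then force the other factor to be one as well.
  product-form-X₂² : ∀ {l m} → (∀ i → ¬ i ≡ 5F → product-form l m i ≈ 0#) →
                     ¬ (product-form l m 5F ≈ 0#) → l ∼ m
  product-form-X₂² {l} {m} eq ≉0 with product-form-factor l m (eq 0F λ ()) (eq 1F λ ()) (eq 3F λ ())
  ... | inj₁ (l₀ , l₁) = only-X₂-∼ l₀ l₁ (cofactor 0F l₀ (eq 2F λ ())) (cofactor 1F l₁ (eq 4F λ ())) ≉0
    where
    cofactor : ∀ i → l i ≈ 0# → l i * m 2F + l 2F * m i ≈ 0# → m i ≈ 0#
    cofactor i lᵢ≈0 eq′ = x*y≈0⇒y≈0 (λ l₂≈0 → ≉0 (trans (*-congʳ l₂≈0) (zeroˡ _)))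
      (trans (sym (trans (+-congʳ (trans (*-congʳ lᵢ≈0) (zeroˡ _))) (+-identityˡ _))) eq′)
  ... | inj₂ (m₀ , m₁) = only-X₂-∼ (cofactor 0F m₀ (eq 2F λ ())) (cofactor 1F m₁ (eq 4F λ ())) m₀ m₁ ≉0
    where
    cofactor : ∀ i → m i ≈ 0# → l i * m 2F + l 2F * m i ≈ 0# → l i ≈ 0#
    cofactor i mᵢ≈0 eq′ = x*y≈0⇒y≈0 (λ m₂≈0 → ≉0 (trans (*-congˡ m₂≈0) (zeroʳ _)))
      (trans (*-comm _ _) (trans (sym (trans (+-congˡ (trans (*-congˡ mᵢ≈0) (zeroʳ _))) (+-identityʳ _))) eq′))

  ∼-normalised : ∀ {n} (a b : Vector Carrier n) i → a i ≈ 1# → b i ≈ 1# → a ∼ b → ∀ j → a j ≈ b j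
  ∼-normalised a b i aᵢ≈1 bᵢ≈1 (k , _ , eq) j = trans (eq j) (trans (*-congʳ k≈1) (*-identityˡ _))
    where
    k≈1 : k ≈ 1#
    k≈1 = begin
      k        ≈⟨ *-identityʳ k ⟨
      k * 1#   ≈⟨ *-congˡ bᵢ≈1 ⟨
      k * b i  ≈⟨ eq i ⟨
      a i      ≈⟨ aᵢ≈1 ⟩
      1#       ∎

-- Forms over `F` viewed over `E`, and conjugate factors.

module ExtendedForms {q c ℓ c′ ℓ′} {F : FiniteField q c ℓ} (X : QuadraticExtension F c′ ℓ′) where
  open QuadraticExtension X
  open QuadraticExtensionProperties X
  private
    module F  = FiniteField F
    module FF = Forms F
    module FE = Forms E
    module PF = Projective F
    module PE = Projective E
  open FiniteField E hiding (zero)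

  ιₘ : PF.Matrix₃ → PE.Matrix₃
  ιₘ A i j = ι (A i j)

  conjₗ : Vector Carrier 3 → Vector Carrier 3
  conjₗ l i = conj (l i)

  private
    infixl 6 _⊞_
    infixl 7 _⊠_
    _⊞_ : ∀ {x y x′ y′} → ι x ≈ x′ → ι y ≈ y′ → ι (x F.+ y) ≈ x′ + y′
    p ⊞ q = trans (ι-+ _ _) (+-cong p q)
    _⊠_ : ∀ {x y x′ y′} → ι x ≈ x′ → ι y ≈ y′ → ι (x F.* y) ≈ x′ * y′
    p ⊠ q = trans (ι-* _ _) (*-cong p q)
    ⊟_ : ∀ {x x′} → ι x ≈ x′ → ι (F.- x) ≈ - x′
    ⊟ p = trans (ι-neg _) (-‿cong p)

  ι-quadratic : ∀ a x → ι (FF.quadratic a x) ≈ FE.quadratic (ι ∘ a) (ι ∘ x)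
  ι-quadratic a x = t 0F 0F 0F ⊞ t 1F 0F 1F ⊞ t 2F 0F 2F ⊞ t 3F 1F 1F ⊞ t 4F 1F 2F ⊞ t 5F 2F 2F
    where t = λ i j k → refl {ι (a i)} ⊠ (refl {ι (x j)} ⊠ refl {ι (x k)})

  ι-polar : ∀ a x y → ι (FF.polar a x y) ≈ FE.polar (ι ∘ a) (ι ∘ x) (ι ∘ y)
  ι-polar a x y = t 0F 0F 0F ⊞ t 1F 0F 1F ⊞ t 2F 0F 2F ⊞ t 3F 1F 1F ⊞ t 4F 1F 2F ⊞ t 5F 2F 2F
    where t = λ i j k → refl {ι (a i)} ⊠ (refl {ι (x j)} ⊠ refl {ι (y k)} ⊞ refl {ι (y j)} ⊠ refl {ι (x k)})

  ι-⋆ : ∀ a A i → ι ((a FF.⋆ A) i) ≈ ((ι ∘ a) FE.⋆ ιₘ A) i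
  ι-⋆ a A = λ
    { 0F → ι-quadratic a (col 0F)
    ; 1F → ι-polar a (col 0F) (col 1F)
    ; 2F → ι-polar a (col 0F) (col 2F)
    ; 3F → ι-quadratic a (col 1F)
    ; 4F → ι-polar a (col 1F) (col 2F)
    ; 5F → ι-quadratic a (col 2F)
    }
    where col = FF.column A

  ι-disc : ∀ a → ι (FF.disc a) ≈ FE.disc (ι ∘ a)
  ι-disc a = (t ⊞ (t ⊞ (t ⊞ (t ⊞ ι-0)))) ⊞ r 1F ⊠ r 2F ⊠ r 4F
           ⊞ ⊟ (r 0F ⊠ (r 4F ⊠ r 4F)) ⊞ ⊟ (r 3F ⊠ (r 2F ⊠ r 2F)) ⊞ ⊟ (r 5F ⊠ (r 1F ⊠ r 1F))
    where
    r : ∀ i → ι (a i) ≈ ι (a i)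
    r i = refl
    t = r 0F ⊠ r 3F ⊠ r 5F

  ι-inverse : ∀ A C → (∀ i j → (A FF.*₃ C) i j F.≈ PF.Iₘ i j) →
              ∀ i j → (ιₘ A FE.*₃ ιₘ C) i j ≈ PE.Iₘ i j
  ι-inverse A C AC≈I i j = trans (sym (t 0F ⊞ (t 1F ⊞ (t 2F ⊞ ι-0))))
    (trans (ι-cong (AC≈I i j)) (ι-if (does (i Finₚ.≟ j))))
    where
    t = λ k → refl {ι (A i k)} ⊠ refl {ι (C k j)}
    ι-if : ∀ b → ι (if b then F.1# else F.0#) ≈ (if b then 1# else 0#)
    ι-if true  = ι-1
    ι-if false = ι-0

  conj-⋆ₗ : ∀ l A j → conj ((l FE.⋆ₗ ιₘ A) j) ≈ (conjₗ l FE.⋆ₗ ιₘ A) j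
  conj-⋆ₗ l A j = trans (conj-+ _ _) (+-cong (t 0F) (trans (conj-+ _ _) (+-cong (t 1F)
                    (trans (conj-+ _ _) (+-cong (t 2F) conj-0)))))
    where
    t : ∀ i → conj (l i * ι (A i j)) ≈ conj (l i) * ι (A i j)
    t i = trans (conj-* _ _) (*-congˡ (conj-ι _))

  -- Substitution over `F` preserves conjugate pairs: it acts on each factor, and `conj` fixes the
  -- entries of the matrix, so the new factors are again conjugate.
  ι-⋆-norm-form : ∀ a k l A → (∀ i → ι (a i) ≈ ι k * FE.product-form l (conjₗ l) i) →
                  ∀ i → ι ((a FF.⋆ A) i) ≈ ι k * FE.product-form (l FE.⋆ₗ ιₘ A) (conjₗ (l FE.⋆ₗ ιₘ A)) i
  ι-⋆-norm-form a k l A eq i = begin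
    ι ((a FF.⋆ A) i)
      ≈⟨ ι-⋆ a A i ⟩
    ((ι ∘ a) FE.⋆ ιₘ A) i
      ≈⟨ FE.⋆-cong {B = ιₘ A} eq (λ _ _ → refl) i ⟩
    ((λ j → ι k * FE.product-form l (conjₗ l) j) FE.⋆ ιₘ A) i
      ≈⟨ FE.⋆-scale (ι k) (FE.product-form l (conjₗ l)) (ιₘ A) i ⟩
    ι k * (FE.product-form l (conjₗ l) FE.⋆ ιₘ A) i
      ≈⟨ *-congˡ (FE.product-form-⋆ l (conjₗ l) (ιₘ A) i) ⟩
    ι k * FE.product-form (l FE.⋆ₗ ιₘ A) (conjₗ l FE.⋆ₗ ιₘ A) i
      ≈⟨ *-congˡ (FE.product-form-cong {l = l FE.⋆ₗ ιₘ A} (λ _ → refl) (λ j → sym (conj-⋆ₗ l A j)) i) ⟩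
    ι k * FE.product-form (l FE.⋆ₗ ιₘ A) (conjₗ (l FE.⋆ₗ ιₘ A)) i ∎
    where open SetoidReasoning setoid

  conjugate-factors-disc : ∀ a k l → (∀ i → ι (a i) ≈ ι k * FE.product-form l (conjₗ l) i) →
                           FF.disc a F.≈ F.0#
  conjugate-factors-disc a k l eq = ι-injective (begin
    ι (FF.disc a)                                          ≈⟨ ι-disc a ⟩
    FE.disc (ι ∘ a)                                        ≈⟨ FE.disc-cong eq ⟩
    FE.disc (λ i → ι k * FE.product-form l (conjₗ l) i)    ≈⟨ FE.disc-scale (ι k) (FE.product-form l (conjₗ l)) ⟩
    ι k * ι k * ι k * FE.disc (FE.product-form l (conjₗ l)) ≈⟨ *-congˡ (FE.disc-product-form l (conjₗ l)) ⟩
    ι k * ι k * ι k * 0#                                   ≈⟨ zeroʳ _ ⟩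
    0#                                                     ≈⟨ ι-0 ⟨
    ι F.0#                                                 ∎)
    where open SetoidReasoning setoid

  conjugate-∼-⋆ₗ : ∀ l A C → (∀ i j → (A FF.*₃ C) i j F.≈ PF.Iₘ i j) →
                   (l FE.⋆ₗ ιₘ A) PE.∼ conjₗ (l FE.⋆ₗ ιₘ A) → l PE.∼ conjₗ l
  conjugate-∼-⋆ₗ l A C AC≈I (k , k≉0 , eq) = FE.∼-⋆ₗ⁻¹ (ιₘ A) (ιₘ C) (ι-inverse A C AC≈I)
    (k , k≉0 , λ j → trans (eq j) (*-congˡ (conj-⋆ₗ l A j)))

  -- If the form vanishes on X₂ = 0, one of `l` and its conjugate vanishes there, hence both do.
  -- Then both are multiples of X₂, nonzero because `a` is, and so proportional. This excludes
  -- `s = 0` for conjugate pairs.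
  conjugate-factors-nonvanishing : ∀ a k l → (∀ i → ι (a i) ≈ ι k * FE.product-form l (conjₗ l) i) →
    PF.NonZero a → a 0F F.≈ F.0# → a 1F F.≈ F.0# → a 3F F.≈ F.0# → l PE.∼ conjₗ l
  conjugate-factors-nonvanishing a k l eq a≉0 a₀ a₁ a₃ =
    FE.only-X₂-∼ (proj₁ l₀₁) (proj₂ l₀₁) (conj-≈0 (proj₁ l₀₁)) (conj-≈0 (proj₂ l₀₁))
      (λ l₂l̄₂≈0 → a≉0 λ i → ι-injective (trans (eq i) (trans (*-congˡ (vanish l₂l̄₂≈0 i)) (trans (zeroʳ _) (sym ι-0)))))
    where
    open FiniteFieldProperties E using (x*y≈0⇒y≈0)
    k≉0 : ¬ (ι k ≈ 0#)
    k≉0 k≈0 = a≉0 λ i → ι-injective (trans (eq i) (trans (*-congʳ k≈0) (trans (zeroˡ _) (sym ι-0))))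
    zero-coefficient : ∀ i → a i F.≈ F.0# → FE.product-form l (conjₗ l) i ≈ 0#
    zero-coefficient i aᵢ≈0 = x*y≈0⇒y≈0 k≉0 (trans (sym (eq i)) (trans (ι-cong aᵢ≈0) ι-0))
    conj-≈0 : ∀ {x} → x ≈ 0# → conj x ≈ 0#
    conj-≈0 x≈0 = trans (conj-cong x≈0) conj-0
    l₀₁ : l 0F ≈ 0# × l 1F ≈ 0#
    l₀₁ = [ (λ p → p) , (λ (p , q) → conj≈0 p , conj≈0 q) ]′
      (FE.product-form-factor l (conjₗ l) (zero-coefficient 0F a₀) (zero-coefficient 1F a₁) (zero-coefficient 3F a₃))
    0*_ : ∀ {x} y → x ≈ 0# → x * y ≈ 0#
    0* y = λ x≈0 → trans (*-congʳ x≈0) (zeroˡ y)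
    *0_ : ∀ x {y} → y ≈ 0# → x * y ≈ 0#
    *0 x = λ y≈0 → trans (*-congˡ y≈0) (zeroʳ x)
    0+0 : ∀ {x y} → x ≈ 0# → y ≈ 0# → x + y ≈ 0#
    0+0 p q = trans (+-cong p q) (+-identityˡ 0#)
    l₀ = proj₁ l₀₁
    l₁ = proj₂ l₀₁
    vanish : l 2F * conj (l 2F) ≈ 0# → ∀ i → FE.product-form l (conjₗ l) i ≈ 0#
    vanish eq′ = λ
      { 0F → (0* _) l₀
      ; 1F → 0+0 ((0* _) l₀) ((0* _) l₁)
      ; 2F → 0+0 ((0* _) l₀) ((*0 _) (conj-≈0 l₀))
      ; 3F → (0* _) l₁
      ; 4F → 0+0 ((0* _) l₁) ((*0 _) (conj-≈0 l₁))
      ; 5F → eq′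
      }

-- Normal forms of the conics attached to the representative line.

-- The forms annihilating the representative line of o₁₀ are those restricting
-- to a multiple of X₀² + e X₀X₁ − v X₁² on X₂ = 0, where e = u v₀ and v = v₀.
module NormalForms {q c ℓ c′ ℓ′} {F : FiniteField q c ℓ} (X : QuadraticExtension F c′ ℓ′)
  (e v : FiniteField.Carrier F) (irreducible : Irreducible F e v) (roots : ConjugateRoots X e v) where
  open FiniteField F hiding (zero)
  open QuadraticExtension X using (E; ι; conj)
  open ConjugateRoots roots
  open QuadraticExtensionProperties X
  open ExtendedForms X
  open FiniteFieldProperties F
  open Forms F
  open Projective F hiding (_⊗_)
  private
    module E  = FiniteField E
    module EP = FiniteFieldProperties E
    module FE = Forms E
    module PE = Projective E
  open SetoidReasoning setoid

  normal : (s b c d : Carrier) → Vector Carrier 6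
  normal s b c d = s ∷ e * s ∷ b ∷ - (v * s) ∷ c ∷ d ∷ []

  normal-cong : ∀ {s s′ b b′ c c′ d d′} → s ≈ s′ → b ≈ b′ → c ≈ c′ → d ≈ d′ →
                ∀ i → normal s b c d i ≈ normal s′ b′ c′ d′ i
  normal-cong s b c d = λ
    { 0F → s
    ; 1F → *-congˡ s
    ; 2F → b
    ; 3F → -‿cong (*-congˡ s)
    ; 4F → c
    ; 5F → d
    }

  normal-scale : ∀ k s b c d i → normal (k * s) (k * b) (k * c) (k * d) i ≈ k * normal s b c d i
  normal-scale k s b c d = λ
    { 0F → refl
    ; 1F → solve 3 (λ k e s → e ⊗ (k ⊗ s) ⊜ k ⊗ (e ⊗ s)) ≡.refl (k Vec.∷ e Vec.∷ s Vec.∷ Vec.[])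
    ; 2F → refl
    ; 3F → solve 3 (λ k v s → ⊝ (v ⊗ (k ⊗ s)) ⊜ k ⊗ ⊝ (v ⊗ s)) ≡.refl (k Vec.∷ v Vec.∷ s Vec.∷ Vec.[])
    ; 4F → refl
    ; 5F → refl
    }

  -- If `s ≠ 0` then `l 0F ≠ 0`, and on the line X₂ = 0 the factor `l` vanishes at `(x, 1)` with
  -- `x = − l₁ / l₀`. This `x` would be a root in `F` of `X² + e X − v`.
  factorable⇒s≈0 : ∀ {s b c d} l m → (∀ i → normal s b c d i ≈ product-form l m i) → s ≈ 0#
  factorable⇒s≈0 {s} l m eq with s ≟ 0#
  ... | yes s≈0 = s≈0
  ... | no  s≉0 with inverse (l 0F) (λ l₀≈0 → s≉0 (trans (eq 0F) (trans (*-congʳ l₀≈0) (zeroˡ _))))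
  ...   | w , l₀w≈1 = contradiction (x*y≈0⇒y≈0 s≉0 (begin
      s * (x * x + e * x - v)
        -- Factors `l 0F * w`, equal to 1, are inserted to make the expression homogeneous; dividing
        -- by `l 0F` then becomes an overall factor `w * w` in a polynomial identity.
        ≈⟨ *-congˡ (+-congˡ (-‿cong (trans (*-congʳ (trans (*-cong l₀w≈1 l₀w≈1) (*-identityˡ 1#))) (*-identityˡ v)))) ⟨
      s * (x * x + e * x - (l 0F * w * (l 0F * w)) * v)
        ≈⟨ *-congˡ (+-congʳ (+-congˡ (trans (*-congʳ l₀w≈1) (*-identityˡ _)))) ⟨
      s * (x * x + (l 0F * w) * (e * x) - (l 0F * w * (l 0F * w)) * v)
        ≈⟨ solve 6 (λ s e v p q w → s ⊗ ((⊝ (q ⊗ w)) ⊗ (⊝ (q ⊗ w)) ⊕ (p ⊗ w) ⊗ (e ⊗ (⊝ (q ⊗ w))) ⊖ (p ⊗ w ⊗ (p ⊗ w)) ⊗ v)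
             ⊜ w ⊗ w ⊗ (q ⊗ q ⊗ s ⊖ p ⊗ q ⊗ (e ⊗ s) ⊕ p ⊗ p ⊗ (⊝ (v ⊗ s)))) ≡.refl
             (s Vec.∷ e Vec.∷ v Vec.∷ l 0F Vec.∷ l 1F Vec.∷ w Vec.∷ Vec.[]) ⟩
      w * w * (l 1F * l 1F * s - l 0F * l 1F * (e * s) + l 0F * l 0F * - (v * s))
        ≈⟨ *-congˡ (+-cong (+-cong (*-congˡ (eq 0F)) (-‿cong (*-congˡ (eq 1F)))) (*-congˡ (eq 3F))) ⟩
      w * w * (l 1F * l 1F * (l 0F * m 0F) - l 0F * l 1F * (l 0F * m 1F + l 1F * m 0F) + l 0F * l 0F * (l 1F * m 1F))
        ≈⟨ solve 5 (λ w a b m n → w ⊗ w ⊗ (b ⊗ b ⊗ (a ⊗ m) ⊖ a ⊗ b ⊗ (a ⊗ n ⊕ b ⊗ m) ⊕ a ⊗ a ⊗ (b ⊗ n)) ⊜ Κ 0ℤ) ≡.refl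
             (w Vec.∷ l 0F Vec.∷ l 1F Vec.∷ m 0F Vec.∷ m 1F Vec.∷ Vec.[]) ⟩
      0# ∎)) (irreducible x)
    where
    x : Carrier
    x = - (l 1F * w)

  X₂ : Vector Carrier 3
  X₂ = 0# ∷ 0# ∷ 1# ∷ []

  X₂*-normal : ∀ b c d i → normal 0# b c d i ≈ product-form X₂ (b ∷ c ∷ d ∷ []) i
  X₂*-normal b c d = λ
    { 0F → sym (zeroˡ b)
    ; 1F → go (λ e v b c d → e ⊗ Κ 0ℤ ⊜ Κ 0ℤ ⊗ c ⊕ Κ 0ℤ ⊗ b) ≡.refl
    ; 2F → go (λ e v b c d → b ⊜ Κ 0ℤ ⊗ d ⊕ Κ 1ℤ ⊗ b) ≡.refl
    ; 3F → go (λ e v b c d → ⊝ (v ⊗ Κ 0ℤ) ⊜ Κ 0ℤ ⊗ c) ≡.refl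
    ; 4F → go (λ e v b c d → c ⊜ Κ 0ℤ ⊗ d ⊕ Κ 1ℤ ⊗ c) ≡.refl
    ; 5F → sym (*-identityˡ d)
    }
    where go = λ f eq → solve 5 f eq (e Vec.∷ v Vec.∷ b Vec.∷ c Vec.∷ d Vec.∷ Vec.[])

  -- f(X₀ + α X₂, X₁ + β X₂) + δ X₂² where f = X₀² + e X₀X₁ − v X₁².
  centred : (α β δ : Carrier) → Vector Carrier 6
  centred α β δ = normal 1# (α + α + e * β) (e * α - (v * β + v * β))
                            (α * α + e * (α * β) - v * (β * β) + δ)

  Δ : Carrier
  Δ = e * e + (v + v + v + v)

  -- By Vieta, the image of `Δ` in `E` is the square of `z - conj z`.
  Δ≉0 : ¬ (Δ ≈ 0#)
  Δ≉0 Δ≈0 = [ z≉z̄ ∘ EP.x-y≈0⇒x≈y , z≉z̄ ∘ EP.x-y≈0⇒x≈y ]′ (EP.x*y≈0⇒x≈0⊎y≈0 (ER.begin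
    (z E.- conj z) E.* (z E.- conj z)
      ER.≈⟨ EP.solve 2 (λ z w → (z EP.⊖ w) ⊗ (z EP.⊖ w) EP.⊜ (z ⊕ w) ⊗ (z ⊕ w) EP.⊖ (z ⊗ w ⊕ z ⊗ w ⊕ z ⊗ w ⊕ z ⊗ w)) ≡.refl (z Vec.∷ conj z Vec.∷ Vec.[]) ⟩
    (z E.+ conj z) E.* (z E.+ conj z) E.- (z E.* conj z E.+ z E.* conj z E.+ z E.* conj z E.+ z E.* conj z)
      ER.≈⟨ E.+-cong (E.*-cong z+z̄ z+z̄) (E.-‿cong (E.+-cong (E.+-cong (E.+-cong zz̄ zz̄) zz̄) zz̄)) ⟩
    (E.- ι e) E.* (E.- ι e) E.- (E.- ι v E.+ E.- ι v E.+ E.- ι v E.+ E.- ι v)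
      ER.≈⟨ EP.solve 2 (λ e v → ⊝ e ⊗ ⊝ e EP.⊖ (⊝ v ⊕ ⊝ v ⊕ ⊝ v ⊕ ⊝ v) EP.⊜ e ⊗ e ⊕ (v ⊕ v ⊕ v ⊕ v)) ≡.refl (ι e Vec.∷ ι v Vec.∷ Vec.[]) ⟩
    ι e E.* ι e E.+ (ι v E.+ ι v E.+ ι v E.+ ι v)
      ER.≈⟨ E.trans (ι-+ _ _) (E.+-cong (ι-* e e) (E.trans (ι-+ _ v) (E.+-congʳ (E.trans (ι-+ _ v) (E.+-congʳ (ι-+ v v)))))) ⟨
    ι Δ ER.≈⟨ ι-cong Δ≈0 ⟩
    ι 0# ER.≈⟨ ι-0 ⟩
    E.0# ER.∎))
    where module ER = SetoidReasoning E.setoid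

  -- The shift by multiples of X₂ has determinant 1, so the value is that of
  -- `X₀² + e X₀X₁ − v X₁² + δ X₂²`, namely `− 4vδ − e²δ`.
  centred-disc : ∀ α β δ → disc (centred α β δ) ≈ - (Δ * δ)
  centred-disc α β δ = solve 5 (λ e v α β δ →
      let b = α ⊕ α ⊕ e ⊗ β
          c = e ⊗ α ⊖ (v ⊗ β ⊕ v ⊗ β)
          d = α ⊗ α ⊕ e ⊗ (α ⊗ β) ⊖ v ⊗ (β ⊗ β) ⊕ δ
          s = Κ 1ℤ
          a₃ = ⊝ (v ⊗ Κ 1ℤ)
          t = s ⊗ a₃ ⊗ d in
      (t ⊕ (t ⊕ (t ⊕ (t ⊕ Κ 0ℤ)))) ⊕ (e ⊗ s) ⊗ b ⊗ c ⊖ s ⊗ (c ⊗ c) ⊖ a₃ ⊗ (b ⊗ b) ⊖ d ⊗ ((e ⊗ s) ⊗ (e ⊗ s))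
      ⊜ ⊝ ((e ⊗ e ⊕ (v ⊕ v ⊕ v ⊕ v)) ⊗ δ)) ≡.refl
    (e Vec.∷ v Vec.∷ α Vec.∷ β Vec.∷ δ Vec.∷ Vec.[])

  centred-disc≈0 : ∀ α β δ → disc (centred α β δ) ≈ 0# → δ ≈ 0#
  centred-disc≈0 α β δ eq = x*y≈0⇒y≈0 Δ≉0
    (-‿injective (trans (sym (centred-disc α β δ)) (trans eq (sym -0#≈0#))))

  normal⇒centred : ∀ s b c d → ¬ (s ≈ 0#) →
                   ∃[ α ] ∃[ β ] ∃[ δ ] (∀ i → normal s b c d i ≈ s * centred α β δ i)
  normal⇒centred s b c d s≉0 with inverse s s≉0 | inverse Δ Δ≉0
  ... | w , sw≈1 | D , ΔD≈1 = α , β , δ , λ i → trans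
      (normal-cong (sym (*-identityʳ s))
        (sym (trans eq-b (one b))) (sym (trans eq-c (one c))) (sym eq-d) i)
      (normal-scale s 1# (α + α + e * β) (e * α - (v * β + v * β)) (α * α + e * (α * β) - v * (β * β) + δ) i)
    where
    α β δ : Carrier
    -- Cramer's rule for `2α + eβ = b / s` and `eα − 2vβ = c / s`, with `w = 1 / s` and `D = 1 / Δ`;
    -- `δ` absorbs what remains of the X₂² coefficient.
    α = D * w * ((v + v) * b + e * c)
    β = D * w * (e * b - (c + c))
    δ = d * w - (α * α + e * (α * β) - v * (β * β))
    one : ∀ x → (s * w) * (Δ * D) * x ≈ x
    one x = trans (*-congʳ (trans (*-cong sw≈1 ΔD≈1) (*-identityˡ 1#))) (*-identityˡ x)
    eq-b : s * (α + α + e * β) ≈ (s * w) * (Δ * D) * b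
    eq-b = solve 7 (λ e v s w D b c →
      let α = D ⊗ w ⊗ ((v ⊕ v) ⊗ b ⊕ e ⊗ c)
          β = D ⊗ w ⊗ (e ⊗ b ⊖ (c ⊕ c)) in
      s ⊗ (α ⊕ α ⊕ e ⊗ β) ⊜ (s ⊗ w) ⊗ ((e ⊗ e ⊕ (v ⊕ v ⊕ v ⊕ v)) ⊗ D) ⊗ b) ≡.refl
      (e Vec.∷ v Vec.∷ s Vec.∷ w Vec.∷ D Vec.∷ b Vec.∷ c Vec.∷ Vec.[])
    eq-c : s * (e * α - (v * β + v * β)) ≈ (s * w) * (Δ * D) * c
    eq-c = solve 7 (λ e v s w D b c →
      let α = D ⊗ w ⊗ ((v ⊕ v) ⊗ b ⊕ e ⊗ c)
          β = D ⊗ w ⊗ (e ⊗ b ⊖ (c ⊕ c)) in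
      s ⊗ (e ⊗ α ⊖ (v ⊗ β ⊕ v ⊗ β)) ⊜ (s ⊗ w) ⊗ ((e ⊗ e ⊕ (v ⊕ v ⊕ v ⊕ v)) ⊗ D) ⊗ c) ≡.refl
      (e Vec.∷ v Vec.∷ s Vec.∷ w Vec.∷ D Vec.∷ b Vec.∷ c Vec.∷ Vec.[])
    eq-d : s * (α * α + e * (α * β) - v * (β * β) + δ) ≈ d
    eq-d = trans (solve 4 (λ s w d x → s ⊗ (x ⊕ (d ⊗ w ⊖ x)) ⊜ (s ⊗ w) ⊗ d) ≡.refl
      (s Vec.∷ w Vec.∷ d Vec.∷ (α * α + e * (α * β) - v * (β * β)) Vec.∷ Vec.[])) (trans (*-congʳ sw≈1) (*-identityˡ d))

  centred-surjective : ∀ a → ¬ (a 0F ≈ 0#) → (∀ i → a i ≈ normal (a 0F) (a 2F) (a 4F) (a 5F) i) →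
                       ∃[ α ] ∃[ β ] ∃[ δ ] centred α β δ ∼ a
  centred-surjective a s≉0 a≈ = proportional (normal⇒centred (a 0F) (a 2F) (a 4F) (a 5F) s≉0)
    where
    proportional : (∃[ α ] ∃[ β ] ∃[ δ ] (∀ i → normal (a 0F) (a 2F) (a 4F) (a 5F) i ≈ a 0F * centred α β δ i)) →
                   ∃[ α ] ∃[ β ] ∃[ δ ] centred α β δ ∼ a
    proportional (α , β , δ , eq) = α , β , δ ,
      ∼-sym {v = a} {w = centred α β δ} (a 0F , s≉0 , λ i → trans (a≈ i) (eq i))

  centred-cong : ∀ {α α′ β β′ δ δ′} → α ≈ α′ → β ≈ β′ → δ ≈ δ′ →
                 ∀ i → centred α β δ i ≈ centred α′ β′ δ′ i
  centred-cong α β δ = normal-cong refl (+-cong (+-cong α α) (*-congˡ β))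
    (+-cong (*-congˡ α) (-‿cong (+-cong (*-congˡ β) (*-congˡ β))))
    (+-cong (+-cong (+-cong (*-cong α α) (*-congˡ (*-cong α β))) (-‿cong (*-congˡ (*-cong β β)))) δ)

  centred-injective : ∀ α β δ α′ β′ δ′ → centred α β δ ∼ centred α′ β′ δ′ →
                      (α ≈ α′ × β ≈ β′) × δ ≈ δ′
  centred-injective α β δ α′ β′ δ′ a∼b = (α≈α′ , β≈β′)
    , +-cancelˡ _ _ _ (trans (sym (+-congʳ (+-cong (+-cong (*-cong α≈α′ α≈α′) (*-congˡ (*-cong α≈α′ β≈β′))) (-‿cong (*-congˡ (*-cong β≈β′ β≈β′)))))) (eq 5F))
    where
    eq : ∀ i → centred α β δ i ≈ centred α′ β′ δ′ i
    eq = ∼-normalised (centred α β δ) (centred α′ β′ δ′) 0F refl refl a∼b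
    b-diff : (α + α + e * β) - (α′ + α′ + e * β′) ≈ 0#
    b-diff = x≈y⇒x-y≈0 (eq 2F)
    c-diff : (e * α - (v * β + v * β)) - (e * α′ - (v * β′ + v * β′)) ≈ 0#
    c-diff = x≈y⇒x-y≈0 (eq 4F)
    -- Cramer's rule again: the weights `(2v, e)` and `(e, −2)` isolate `Δ (α − α′)` and
    -- `Δ (β − β′)`.
    combine-diffs : ∀ x y → x * ((α + α + e * β) - (α′ + α′ + e * β′))
                      + y * ((e * α - (v * β + v * β)) - (e * α′ - (v * β′ + v * β′))) ≈ 0#
    combine-diffs x y = trans (+-cong (trans (*-congˡ b-diff) (zeroʳ x)) (trans (*-congˡ c-diff) (zeroʳ y))) (+-identityˡ 0#)
    vars = e Vec.∷ v Vec.∷ α Vec.∷ β Vec.∷ α′ Vec.∷ β′ Vec.∷ Vec.[]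
    α≈α′ : α ≈ α′
    α≈α′ = x-y≈0⇒x≈y (x*y≈0⇒y≈0 Δ≉0 (trans (solve 6 (λ e v α β α′ β′ →
      (e ⊗ e ⊕ (v ⊕ v ⊕ v ⊕ v)) ⊗ (α ⊖ α′) ⊜
      (v ⊕ v) ⊗ ((α ⊕ α ⊕ e ⊗ β) ⊖ (α′ ⊕ α′ ⊕ e ⊗ β′)) ⊕ e ⊗ ((e ⊗ α ⊖ (v ⊗ β ⊕ v ⊗ β)) ⊖ (e ⊗ α′ ⊖ (v ⊗ β′ ⊕ v ⊗ β′))))
      ≡.refl vars) (combine-diffs (v + v) e)))
    β≈β′ : β ≈ β′
    β≈β′ = x-y≈0⇒x≈y (x*y≈0⇒y≈0 Δ≉0 (trans (solve 6 (λ e v α β α′ β′ →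
      (e ⊗ e ⊕ (v ⊕ v ⊕ v ⊕ v)) ⊗ (β ⊖ β′) ⊜
      e ⊗ ((α ⊕ α ⊕ e ⊗ β) ⊖ (α′ ⊕ α′ ⊕ e ⊗ β′)) ⊕ (⊝ (Κ 1ℤ ⊕ Κ 1ℤ)) ⊗ ((e ⊗ α ⊖ (v ⊗ β ⊕ v ⊗ β)) ⊖ (e ⊗ α′ ⊖ (v ⊗ β′ ⊕ v ⊗ β′))))
      ≡.refl vars) (combine-diffs e (- (1# + 1#)))))

  -- The factor `X₀ − z X₁` of `X₀² + e X₀X₁ − v X₁²` after the shift that defines `centred`.
  factor : (α β : Carrier) → Vector E.Carrier 3
  factor α β = E.1# ∷ E.- z ∷ ι α E.- z E.* ι β ∷ []

  factor-≁-conj : ∀ α β → ¬ (factor α β PE.∼ conjₗ (factor α β))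
  factor-≁-conj α β l∼l̄ = z≉z̄ (EP.-‿injective (E.trans
    (FE.∼-normalised (factor α β) (conjₗ (factor α β)) 0F E.refl conj-1 l∼l̄ 1F) (conj-neg z)))

  ι-centred : ∀ α β i → ι (centred α β 0# i) E.≈ ι 1# E.* FE.product-form (factor α β) (conjₗ (factor α β)) i
  ι-centred α β i = E.trans (go i) (E.sym (E.trans (E.*-congʳ ι-1) (E.trans (E.*-identityˡ _)
      (FE.product-form-cong {l = factor α β} (λ _ → E.refl) conj-factor i))))
    where
    a b e′ v′ : E.Carrier
    a  = ι α
    b  = ι β
    e′ = ι e
    v′ = ι v
    l̄ : Vector E.Carrier 3
    l̄ = E.1# ∷ E.- conj z ∷ a E.- conj z E.* b ∷ []
    conj-factor : ∀ i → conj (factor α β i) E.≈ l̄ i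
    conj-factor = λ
      { 0F → conj-1
      ; 1F → conj-neg z
      ; 2F → E.trans (conj-+ _ _) (E.+-cong (conj-ι α) (E.trans (conj-neg _) (E.-‿cong (E.trans (conj-* _ _) (E.*-congˡ (conj-ι β))))))
      }
    -ez : E.- (z E.+ conj z) E.≈ e′
    -ez = E.trans (E.-‿cong z+z̄) (EP.-‿involutive _)
    -vz : E.- (z E.* conj z) E.≈ v′
    -vz = E.trans (E.-‿cong zz̄) (EP.-‿involutive _)
    vars = z Vec.∷ conj z Vec.∷ a Vec.∷ b Vec.∷ Vec.[]
    ι-b : ι (α + α + e * β) E.≈ a E.+ a E.+ e′ E.* b
    ι-b = E.trans (ι-+ _ _) (E.+-cong (ι-+ α α) (ι-* e β))
    ι-c : ι (e * α - (v * β + v * β)) E.≈ e′ E.* a E.- (v′ E.* b E.+ v′ E.* b)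
    ι-c = E.trans (ι-∸ _ _) (E.+-cong (ι-* e α) (E.-‿cong (E.trans (ι-+ _ _) (E.+-cong (ι-* v β) (ι-* v β)))))
    ι-d : ι (α * α + e * (α * β) - v * (β * β) + 0#) E.≈ a E.* a E.+ e′ E.* (a E.* b) E.- v′ E.* (b E.* b)
    ι-d = E.trans (ι-cong (+-identityʳ _)) (E.trans (ι-∸ _ _) (E.+-cong (E.trans (ι-+ _ _) (E.+-cong (ι-* α α)
            (E.trans (ι-* e _) (E.*-congˡ (ι-* α β))))) (E.-‿cong (E.trans (ι-* v _) (E.*-congˡ (ι-* β β))))))
    go : ∀ i → ι (centred α β 0# i) E.≈ FE.product-form (factor α β) l̄ i
    go = λ
      { 0F → E.trans ι-1 (E.sym (E.*-identityˡ E.1#))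
      ; 1F → E.trans (ι-cong (*-identityʳ e)) (E.trans (E.sym -ez)
               (EP.solve 4 (λ z w a b → ⊝ (z ⊕ w) EP.⊜ Κ 1ℤ ⊗ ⊝ w ⊕ ⊝ z ⊗ Κ 1ℤ) ≡.refl vars))
      ; 2F → E.trans ι-b (E.trans (E.+-congˡ (E.*-congʳ (E.sym -ez)))
               (EP.solve 4 (λ z w a b → a ⊕ a ⊕ ⊝ (z ⊕ w) ⊗ b EP.⊜ Κ 1ℤ ⊗ (a EP.⊖ w ⊗ b) ⊕ (a EP.⊖ z ⊗ b) ⊗ Κ 1ℤ) ≡.refl vars))
      ; 3F → E.trans (ι-cong (-‿cong (*-identityʳ v))) (E.trans (ι-neg v) (E.trans (E.sym zz̄)
               (EP.solve 4 (λ z w a b → z ⊗ w EP.⊜ ⊝ z ⊗ ⊝ w) ≡.refl vars)))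
      ; 4F → E.trans ι-c (E.trans (E.+-cong (E.*-congʳ (E.sym -ez)) (E.-‿cong (E.+-cong (E.*-congʳ (E.sym -vz)) (E.*-congʳ (E.sym -vz)))))
               (EP.solve 4 (λ z w a b → ⊝ (z ⊕ w) ⊗ a EP.⊖ (⊝ (z ⊗ w) ⊗ b ⊕ ⊝ (z ⊗ w) ⊗ b)
                  EP.⊜ ⊝ z ⊗ (a EP.⊖ w ⊗ b) ⊕ (a EP.⊖ z ⊗ b) ⊗ ⊝ w) ≡.refl vars))
      ; 5F → E.trans ι-d (E.trans (E.+-cong (E.+-congˡ (E.*-congʳ (E.sym -ez))) (E.-‿cong (E.*-congʳ (E.sym -vz))))
               (EP.solve 4 (λ z w a b → a ⊗ a ⊕ ⊝ (z ⊕ w) ⊗ (a ⊗ b) EP.⊖ ⊝ (z ⊗ w) ⊗ (b ⊗ b)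
                  EP.⊜ (a EP.⊖ z ⊗ b) ⊗ (a EP.⊖ w ⊗ b)) ≡.refl vars))
      }

-- Counting the hyperplanes through the line, class by class.

module HyperplanesThroughLine {q c ℓ c′ ℓ′} {F : FiniteField q c ℓ} (X : QuadraticExtension F c′ ℓ′)
  (L : Projective.Line F 5) (u v : FiniteField.Carrier F) (v≉0 : ¬ FiniteField._≈_ F v (FiniteField.0# F))
  (irreducible : Irreducible F (FiniteField._*_ F u v) v) (roots : ConjugateRoots X (FiniteField._*_ F u v) v)
  (g : Projective.GL₃ F)
  (L≐ : Projective.points F L ≐ Projective.image F g (Projective.o₁₀-representative F u v)) where
  open FiniteField F hiding (zero)
  open Projective F hiding (_⊗_)
  open QuadraticExtension X using (E)
  open FiniteFieldProperties F
  open Forms F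
  open ExtendedForms X
  open NormalForms X (u * v) v irreducible roots
  open GL₃ g using (inverseʳ; inverseˡ) renaming (mat to A; inv to C)
  open SetoidReasoning setoid
  private
    module FE = Forms E
    module PE = Projective E

  pullback : Hyperplane → Vector Carrier 6
  pullback H = coords H ⋆ A

  pullback-⋆ : ∀ H i → (pullback H ⋆ C) i ≈ coords H i
  pullback-⋆ H = ⋆-inverse A C inverseʳ (coords H)

  pullback-nonZero : ∀ H → NonZero (pullback H)
  pullback-nonZero H eq = proj₂ H λ i → trans (sym (pullback-⋆ H i)) (⋆-zero C eq i)

  pushforward : (a : Vector Carrier 6) → NonZero a → Hyperplane
  pushforward a a≉0 = a ⋆ C , λ eq → a≉0 λ i → trans (sym (⋆-inverse C A inverseˡ a i)) (⋆-zero A eq i)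

  pushforward-∼ : ∀ a b → a ∼ b → (a ⋆ C) ∼ (b ⋆ C)
  pushforward-∼ a b = ∼-⋆ {a} {b} C

  pushforward-injective : ∀ a b → (a ⋆ C) ∼ (b ⋆ C) → a ∼ b
  pushforward-injective a b eq = ∼-trans (≈⇒∼ λ i → sym (⋆-inverse C A inverseˡ a i))
    (∼-trans (∼-⋆ {a ⋆ C} {b ⋆ C} A eq) (≈⇒∼ (⋆-inverse C A inverseˡ b)))

  pushforward-pullback : ∀ a H → a ∼ pullback H → (a ⋆ C) ∼ coords H
  pushforward-pullback a H eq = ∼-trans (∼-⋆ {a} {pullback H} C eq) (≈⇒∼ (pullback-⋆ H))

  private
    representative : (x y : Carrier) → Vector Carrier 6
    representative x y = fromMatrix (o₁₀-matrix u v x y)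

    -- The coefficients of `x` and `y` are the two conditions for a form to annihilate the line;
    -- they give `a₃ = − v a₀` and `a₁ = u v a₀`, the shape of `normal`.
    pairing-representative : ∀ a x y → ⟨ a , representative x y ⟩ ≈
                             x * (v * a 0F + a 3F) + y * (a 1F + u * a 3F)
    pairing-representative a x y = solve 10 (λ u v x y a₀ a₁ a₂ a₃ a₄ a₅ →
        a₀ ⊗ (v ⊗ x) ⊕ (a₁ ⊗ y ⊕ (a₂ ⊗ Κ 0ℤ ⊕ (a₃ ⊗ (x ⊕ u ⊗ y) ⊕ (a₄ ⊗ Κ 0ℤ ⊕ (a₅ ⊗ Κ 0ℤ ⊕ Κ 0ℤ)))))
        ⊜ x ⊗ (v ⊗ a₀ ⊕ a₃) ⊕ y ⊗ (a₁ ⊕ u ⊗ a₃)) ≡.refl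
      (u Vec.∷ v Vec.∷ x Vec.∷ y Vec.∷ Vec.tabulate a)

    -- A transformed representative counts as a point only once it is known to be nonzero. A form
    -- that does not vanish on `y`, transported by `C`, certifies this.
    ∙-nonZero : ∀ a y → ¬ (⟨ a , y ⟩ ≈ 0#) → NonZero (g ∙ y)
    ∙-nonZero a y ay≉0 eq = ay≉0 (begin
      ⟨ a , y ⟩                                  ≈⟨ ⟨⟩-congˡ y (⋆-inverse C A inverseˡ a) ⟨
      ⟨ (a ⋆ C) ⋆ A , y ⟩                        ≈⟨ ⟨⟩-adjoint (a ⋆ C) A y ⟨
      ⟨ a ⋆ C , g ∙ y ⟩                          ≈⟨ ⟨⟩-congʳ (a ⋆ C) (λ i → trans (eq i) (sym (zeroˡ 0#))) ⟩
      ⟨ a ⋆ C , (λ _ → 0# * 0#) ⟩               ≈⟨ ⟨⟩-scale (a ⋆ C) 0# (λ _ → 0#) ⟩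
      0# * ⟨ a ⋆ C , (λ _ → 0#) ⟩               ≈⟨ zeroˡ _ ⟩
      0#                                         ∎)

    ⊇-representative : ∀ {H} → H ⊇ L → (p : Point 1) (a : Vector Carrier 6) →
                       ¬ (⟨ a , representative (coords p 0F) (coords p 1F) ⟩ ≈ 0#) →
                       ⟨ pullback H , representative (coords p 0F) (coords p 1F) ⟩ ≈ 0#
    ⊇-representative {H} H⊇L p a ay≉0 = trans (sym (⟨⟩-adjoint (coords H) A y))
      (H⊇L R
        (proj₂ L≐ {R} ((y , λ eq → ∙-nonZero a y ay≉0 (∙-zero eq)) , (p , ∼-refl) , ∼-refl)))
      where
      y : Vector Carrier 6
      y = representative (coords p 0F) (coords p 1F)
      R : Point 5
      R = g ∙ y , ∙-nonZero a y ay≉0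
      ∙-zero : (∀ i → y i ≈ 0#) → ∀ i → (g ∙ y) i ≈ 0#
      ∙-zero eq = contradiction (trans (⟨⟩-congʳ a (λ i → trans (eq i) (sym (zeroˡ 0#))))
        (trans (⟨⟩-scale a 0# (λ _ → 0#)) (zeroˡ _))) ay≉0

  ⊇⇒normal : ∀ {H} → H ⊇ L → (let a = pullback H) →
             ∀ i → a i ≈ normal (a 0F) (a 2F) (a 4F) (a 5F) i
  ⊇⇒normal {H} H⊇L = λ
    { 0F → refl
    ; 1F → a₁
    ; 2F → refl
    ; 3F → a₃
    ; 4F → refl
    ; 5F → refl
    }
    where
    a = pullback H
    -- These forms take the values `v` and 1 on the representatives with parameters (1, 0) and (0,
    -- 1), which are therefore nonzero; the two points yield one linear condition each.
    ε₀ ε₁ : Vector Carrier 6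
    ε₀ = 1# ∷ 0# ∷ 0# ∷ 0# ∷ 0# ∷ 0# ∷ []
    ε₁ = 0# ∷ 1# ∷ 0# ∷ 0# ∷ 0# ∷ 0# ∷ []
    p₁ p₂ : Point 1
    p₁ = (1# ∷ 0# ∷ []) , λ eq → 1≉0 (eq 0F)
    p₂ = (0# ∷ 1# ∷ []) , λ eq → 1≉0 (eq 1F)
    at₁ : 1# * (v * a 0F + a 3F) + 0# * (a 1F + u * a 3F) ≈ 0#
    at₁ = trans (sym (pairing-representative a 1# 0#))
      (⊇-representative {H} H⊇L p₁ ε₀
        (λ eq → v≉0 (trans (sym (trans (pairing-representative ε₀ 1# 0#)
          (solve 2 (λ u v → Κ 1ℤ ⊗ (v ⊗ Κ 1ℤ ⊕ Κ 0ℤ) ⊕ Κ 0ℤ ⊗ (Κ 0ℤ ⊕ u ⊗ Κ 0ℤ) ⊜ v) ≡.refl (u Vec.∷ v Vec.∷ Vec.[])))) eq)))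
    at₂ : 0# * (v * a 0F + a 3F) + 1# * (a 1F + u * a 3F) ≈ 0#
    at₂ = trans (sym (pairing-representative a 0# 1#))
      (⊇-representative {H} H⊇L p₂ ε₁
        (λ eq → 1≉0 (trans (sym (trans (pairing-representative ε₁ 0# 1#)
          (solve 2 (λ u v → Κ 0ℤ ⊗ (v ⊗ Κ 0ℤ ⊕ Κ 0ℤ) ⊕ Κ 1ℤ ⊗ (Κ 1ℤ ⊕ u ⊗ Κ 0ℤ) ⊜ Κ 1ℤ) ≡.refl (u Vec.∷ v Vec.∷ Vec.[])))) eq)))
    vars = u Vec.∷ v Vec.∷ a 0F Vec.∷ a 1F Vec.∷ a 3F Vec.∷ Vec.[]
    a₃ : a 3F ≈ - (v * a 0F)
    a₃ = x-y≈0⇒x≈y (trans (solve 5 (λ u v a₀ a₁ a₃ → a₃ ⊖ ⊝ (v ⊗ a₀) ⊜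
           Κ 1ℤ ⊗ (v ⊗ a₀ ⊕ a₃) ⊕ Κ 0ℤ ⊗ (a₁ ⊕ u ⊗ a₃)) ≡.refl vars) at₁)
    a₁ : a 1F ≈ u * v * a 0F
    a₁ = x-y≈0⇒x≈y (begin
      a 1F - u * v * a 0F
        ≈⟨ solve 5 (λ u v a₀ a₁ a₃ → a₁ ⊖ u ⊗ v ⊗ a₀ ⊜ (Κ 0ℤ ⊗ (v ⊗ a₀ ⊕ a₃) ⊕ Κ 1ℤ ⊗ (a₁ ⊕ u ⊗ a₃))
             ⊖ u ⊗ (Κ 1ℤ ⊗ (v ⊗ a₀ ⊕ a₃) ⊕ Κ 0ℤ ⊗ (a₁ ⊕ u ⊗ a₃))) ≡.refl vars ⟩
      (0# * (v * a 0F + a 3F) + 1# * (a 1F + u * a 3F))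
        - u * (1# * (v * a 0F + a 3F) + 0# * (a 1F + u * a 3F))
        ≈⟨ +-cong at₂ (-‿cong (trans (*-congˡ at₁) (zeroʳ u))) ⟩
      0# - 0#   ≈⟨ -‿inverseʳ 0# ⟩
      0#         ∎)

  normal⇒⊇ : ∀ s b c d n≉0 → pushforward (normal s b c d) n≉0 ⊇ L
  normal⇒⊇ s b c d n≉0 R R∈L with proj₁ L≐ {R} R∈L
  ... | P , (p , (k , _ , P≈)) , (m , _ , R≈) = begin
    ⟨ N ⋆ C , coords R ⟩                      ≈⟨ ⟨⟩-congʳ (N ⋆ C) R≈ ⟩
    ⟨ N ⋆ C , (λ i → m * (g ∙ coords P) i) ⟩ ≈⟨ ⟨⟩-scale (N ⋆ C) m (g ∙ coords P) ⟩
    m * ⟨ N ⋆ C , g ∙ coords P ⟩             ≈⟨ *-congˡ (⟨⟩-adjoint (N ⋆ C) A (coords P)) ⟩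
    m * ⟨ (N ⋆ C) ⋆ A , coords P ⟩           ≈⟨ *-congˡ (⟨⟩-congˡ (coords P) (⋆-inverse C A inverseˡ N)) ⟩
    m * ⟨ N , coords P ⟩                     ≈⟨ *-congˡ (⟨⟩-congʳ N P≈) ⟩
    m * ⟨ N , (λ i → k * representative x y i) ⟩ ≈⟨ *-congˡ (⟨⟩-scale N k (representative x y)) ⟩
    m * (k * ⟨ N , representative x y ⟩)    ≈⟨ *-congˡ (*-congˡ (pairing-representative N x y)) ⟩
    m * (k * (x * (v * s - v * s) + y * (u * v * s + u * - (v * s))))
      ≈⟨ solve 7 (λ m k x y u v s → m ⊗ (k ⊗ (x ⊗ (v ⊗ s ⊖ v ⊗ s) ⊕ y ⊗ (u ⊗ v ⊗ s ⊕ u ⊗ ⊝ (v ⊗ s)))) ⊜ Κ 0ℤ) ≡.refl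
           (m Vec.∷ k Vec.∷ x Vec.∷ y Vec.∷ u Vec.∷ v Vec.∷ s Vec.∷ Vec.[]) ⟩
    0# ∎
    where
    N = normal s b c d
    x = coords p 0F
    y = coords p 1F

  normal-s≈0 : ∀ {H} → H ⊇ L → (let a = pullback H) → a 0F ≈ 0# → ∀ i → a i ≈ normal 0# (a 2F) (a 4F) (a 5F) i
  normal-s≈0 {H} H⊇L a₀≈0 i = trans (⊇⇒normal {H} H⊇L i) (normal-cong a₀≈0 refl refl refl i)

  X₂²-nonZero : NonZero (normal 0# 0# 0# 1#)
  X₂²-nonZero eq = 1≉0 (eq 5F)

  ℋ₁-size : HasSize (hyperplanesThrough L ℋ₁) 1
  ℋ₁-size = enumerate (hyperplanesThrough L ℋ₁)
    (λ _ → pushforward (normal 0# 0# 0# 1#) X₂²-nonZero , X₂²-double , normal⇒⊇ 0# 0# 0# 1# X₂²-nonZero)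
    (λ {i} {j} _ → Fin1-unique i j)
    (λ (H , H∈ℋ₁ , H⊇L) → 0F , pushforward-pullback (normal 0# 0# 0# 1#) H (∼-sym (pullback-∼ H H∈ℋ₁ H⊇L)))
    where
    X₂²-double : ℋ₁ (pushforward (normal 0# 0# 0# 1#) X₂²-nonZero)
    X₂²-double = 1# , X₂ ⋆ₗ C , λ i → begin
      (normal 0# 0# 0# 1# ⋆ C) i                  ≈⟨ ⋆-cong {B = C} (X₂*-normal 0# 0# 1#) (λ _ _ → refl) i ⟩
      (product-form X₂ X₂ ⋆ C) i                  ≈⟨ product-form-⋆ X₂ X₂ C i ⟩
      product-form (X₂ ⋆ₗ C) (X₂ ⋆ₗ C) i          ≈⟨ *-identityˡ _ ⟨
      1# * product-form (X₂ ⋆ₗ C) (X₂ ⋆ₗ C) i    ∎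
    pullback-∼ : ∀ H → ℋ₁ H → H ⊇ L → pullback H ∼ normal 0# 0# 0# 1#
    pullback-∼ H (k , l , H≈) H⊇L = a 5F , a₅≉0 , λ i → trans (a≈ i)
        (trans (normal-cong (sym (zeroʳ _)) (sym (zeroʳ _)) (sym (zeroʳ _)) (sym (*-identityʳ _)) i)
               (normal-scale (a 5F) 0# 0# 0# 1# i))
      where
      a = pullback H
      l′ = l ⋆ₗ A
      -- The scalar is absorbed into one factor, so that the lemmas on products of linear forms
      -- apply.
      kl′ : Vector Carrier 3
      kl′ i = k * l′ i
      factored : ∀ i → a i ≈ product-form kl′ l′ i
      factored i = begin
        (coords H ⋆ A) i                            ≈⟨ ⋆-cong {B = A} H≈ (λ _ _ → refl) i ⟩
        ((λ i → k * product-form l l i) ⋆ A) i     ≈⟨ ⋆-scale k (product-form l l) A i ⟩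
        k * (product-form l l ⋆ A) i               ≈⟨ *-congˡ (product-form-⋆ l l A i) ⟩
        k * product-form l′ l′ i                   ≈⟨ product-form-scaleˡ k l′ l′ i ⟨
        product-form kl′ l′ i                       ∎
      a₀≈0 : a 0F ≈ 0#
      a₀≈0 = factorable⇒s≈0 kl′ l′ λ i → trans (sym (⊇⇒normal {H} H⊇L i)) (factored i)
      a′ : ∀ i → a i ≈ normal 0# (a 2F) (a 4F) (a 5F) i
      a′ = normal-s≈0 {H} H⊇L a₀≈0
      -- The coefficient of XᵢX₂ is `2 k l′ᵢ l′₂`, which is zero in either alternative of
      -- `vanishing`, with no case distinction on `k`.
      cross : ∀ i → kl′ i ≈ 0# ⊎ l′ i ≈ 0# → kl′ i * l′ 2F + kl′ 2F * l′ i ≈ 0#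
      cross i (inj₁ eq) = trans (solve 3 (λ k x y → (k ⊗ x) ⊗ y ⊕ (k ⊗ y) ⊗ x ⊜ (k ⊗ x) ⊗ (y ⊕ y)) ≡.refl (k Vec.∷ l′ i Vec.∷ l′ 2F Vec.∷ Vec.[]))
        (trans (*-congʳ eq) (zeroˡ _))
      cross i (inj₂ eq) = trans (solve 3 (λ k x y → (k ⊗ x) ⊗ y ⊕ (k ⊗ y) ⊗ x ⊜ (k ⊗ (y ⊕ y)) ⊗ x) ≡.refl (k Vec.∷ l′ i Vec.∷ l′ 2F Vec.∷ Vec.[]))
        (trans (*-congˡ eq) (zeroʳ _))
      product-zero : ∀ i → a i ≈ normal 0# (a 2F) (a 4F) (a 5F) i → normal 0# (a 2F) (a 4F) (a 5F) i ≈ 0# →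
                     product-form kl′ l′ i ≈ 0#
      product-zero i eq n≈0 = trans (sym (factored i)) (trans eq n≈0)
      vanishing : (kl′ 0F ≈ 0# × kl′ 1F ≈ 0#) ⊎ (l′ 0F ≈ 0# × l′ 1F ≈ 0#)
      vanishing = product-form-factor kl′ l′
        (product-zero 0F (a′ 0F) refl) (product-zero 1F (a′ 1F) (zeroʳ _))
        (product-zero 3F (a′ 3F) (trans (-‿cong (zeroʳ v)) -0#≈0#))
      a₂≈0 : a 2F ≈ 0#
      a₂≈0 = trans (factored 2F) (cross 0F ([ inj₁ ∘ proj₁ , inj₂ ∘ proj₁ ]′ vanishing))
      a₄≈0 : a 4F ≈ 0#
      a₄≈0 = trans (factored 4F) (cross 1F ([ inj₁ ∘ proj₂ , inj₂ ∘ proj₂ ]′ vanishing))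
      a≈ : ∀ i → a i ≈ normal 0# 0# 0# (a 5F) i
      a≈ i = trans (a′ i) (normal-cong refl a₂≈0 a₄≈0 refl i)
      a₅≉0 : ¬ (a 5F ≈ 0#)
      a₅≉0 a₅≈0 = pullback-nonZero H λ i → trans (a≈ i) (trans (normal-cong (sym (zeroˡ 0#)) (sym (zeroˡ 0#)) (sym (zeroˡ 0#)) (trans a₅≈0 (sym (zeroˡ 0#))) i)
        (trans (normal-scale 0# 0# 0# 0# 0# i) (zeroˡ _)))

  normal-∼ : ∀ {a s b c d} s′ b′ c′ d′ k → ¬ (k ≈ 0#) → (∀ i → a i ≈ normal s b c d i) →
             s ≈ k * s′ → b ≈ k * b′ → c ≈ k * c′ → d ≈ k * d′ → normal s′ b′ c′ d′ ∼ a
  normal-∼ {a} s′ b′ c′ d′ k k≉0 a≈ s≈ b≈ c≈ d≈ = ∼-sym {v = a} {w = normal s′ b′ c′ d′} (k , k≉0 , λ i →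
    trans (a≈ i) (trans (normal-cong s≈ b≈ c≈ d≈ i) (normal-scale k s′ b′ c′ d′ i)))

  -- X₂ times `b X₀ + c X₁ + d X₂`, where the pair `(b, c)`, nonzero because the lines are distinct,
  -- is scaled to `(1, c)` or `(0, 1)`. The two shapes account for `q²` and `q`.
  realPair : (Carrier × Carrier) ⊎ Carrier → Vector Carrier 6
  realPair (inj₁ (c , d)) = normal 0# 1# c d
  realPair (inj₂ d)       = normal 0# 0# 1# d

  realPair-nonZero : ∀ x → NonZero (realPair x)
  realPair-nonZero (inj₁ _) eq = 1≉0 (eq 2F)
  realPair-nonZero (inj₂ _) eq = 1≉0 (eq 4F)

  realPair-surjective : ∀ a → (∀ i → a i ≈ normal 0# (a 2F) (a 4F) (a 5F) i) →
                        ¬ (a 2F ≈ 0# × a 4F ≈ 0#) → ∃[ x ] realPair x ∼ a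
  realPair-surjective a a≈ bc≉0 = go (a 2F ≟ 0#) (a 4F ≟ 0#)
    where
    divide : ∀ {k w} x → k * w ≈ 1# → x ≈ k * (w * x)
    divide {k} {w} x kw≈1 = sym (trans (sym (*-assoc k w x)) (trans (*-congʳ kw≈1) (*-identityˡ x)))
    go : Dec (a 2F ≈ 0#) → Dec (a 4F ≈ 0#) → ∃[ x ] realPair x ∼ a
    go (no b≉0) _ with inverse (a 2F) b≉0
    ... | w , bw≈1 = inj₁ (w * a 4F , w * a 5F) ,
      normal-∼ 0# 1# (w * a 4F) (w * a 5F) (a 2F) b≉0 a≈
        (sym (zeroʳ _)) (sym (*-identityʳ _)) (divide (a 4F) bw≈1) (divide (a 5F) bw≈1)
    go (yes b≈0) (no c≉0) with inverse (a 4F) c≉0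
    ... | w , cw≈1 = inj₂ (w * a 5F) ,
      normal-∼ 0# 0# 1# (w * a 5F) (a 4F) c≉0 a≈
        (sym (zeroʳ _)) (trans b≈0 (sym (zeroʳ _))) (sym (*-identityʳ _)) (divide (a 5F) cw≈1)
    go (yes b≈0) (yes c≈0) = contradiction (b≈0 , c≈0) bc≉0

  s≈0⇒ℋ₂ᵣ : ∀ b c d n≉0 → ¬ (b ≈ 0# × c ≈ 0#) → ℋ₂ᵣ (pushforward (normal 0# b c d) n≉0)
  s≈0⇒ℋ₂ᵣ b c d n≉0 bc≉0 = X₂ ⋆ₗ C , m ⋆ₗ C , not-proportional , λ i →
    trans (⋆-cong {B = C} (X₂*-normal b c d) (λ _ _ → refl) i) (product-form-⋆ X₂ m C i)
    where
    m : Vector Carrier 3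
    m = b ∷ c ∷ d ∷ []
    X₂≁m : ¬ (X₂ ∼ m)
    X₂≁m (k , k≉0 , X₂≈) = bc≉0 (x*y≈0⇒y≈0 k≉0 (sym (X₂≈ 0F)) , x*y≈0⇒y≈0 k≉0 (sym (X₂≈ 1F)))
    not-proportional : ¬ ((X₂ ⋆ₗ C) ∼ (m ⋆ₗ C))
    not-proportional eq = X₂≁m (∼-⋆ₗ⁻¹ {X₂} {m} C A inverseˡ eq)

  -- A factorable form has `s = 0`. If the X₀X₂ and X₁X₂ coefficients vanished too, only X₂² would
  -- remain and the two lines would coincide.
  ℋ₂ᵣ⇒normal : ∀ H → ℋ₂ᵣ H → H ⊇ L → (let a = pullback H) →
               (∀ i → a i ≈ normal 0# (a 2F) (a 4F) (a 5F) i) × ¬ (a 2F ≈ 0# × a 4F ≈ 0#)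
  ℋ₂ᵣ⇒normal H (l , m , l≁m , H≈) H⊇L = a≈ , λ (a₂≈0 , a₄≈0) →
      l≁m (∼-⋆ₗ⁻¹ {l} {m} A C inverseʳ (product-form-X₂²
        (λ i i≢5 → trans (sym (factored i)) (others a₂≈0 a₄≈0 i i≢5))
        (λ eq → pullback-nonZero H λ i → all a₂≈0 a₄≈0 (trans (factored 5F) eq) i)))
    where
    a = pullback H
    factored : ∀ i → a i ≈ product-form (l ⋆ₗ A) (m ⋆ₗ A) i
    factored i = trans (⋆-cong {B = A} H≈ (λ _ _ → refl) i) (product-form-⋆ l m A i)
    a≈ : ∀ i → a i ≈ normal 0# (a 2F) (a 4F) (a 5F) i
    a≈ = normal-s≈0 {H} H⊇L
      (factorable⇒s≈0 (l ⋆ₗ A) (m ⋆ₗ A) λ i → trans (sym (⊇⇒normal {H} H⊇L i)) (factored i))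
    others : a 2F ≈ 0# → a 4F ≈ 0# → ∀ i → ¬ i ≡ 5F → a i ≈ 0#
    others a₂≈0 a₄≈0 = λ
      { 0F _ → a≈ 0F
      ; 1F _ → trans (a≈ 1F) (zeroʳ _)
      ; 2F _ → a₂≈0
      ; 3F _ → trans (a≈ 3F) (trans (-‿cong (zeroʳ v)) -0#≈0#)
      ; 4F _ → a₄≈0
      ; 5F 5≢5 → contradiction ≡.refl 5≢5
      }
    all : a 2F ≈ 0# → a 4F ≈ 0# → a 5F ≈ 0# → ∀ i → a i ≈ 0#
    all a₂≈0 a₄≈0 a₅≈0 i with i Finₚ.≟ 5F
    ... | yes ≡.refl = a₅≈0
    ... | no  i≢5    = others a₂≈0 a₄≈0 i i≢5

  ℋ₂ᵣ-size : HasSize (hyperplanesThrough L ℋ₂ᵣ) (q ℕ.* q ℕ.+ q)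
  ℋ₂ᵣ-size = transfer (hyperplanesThrough L ℋ₂ᵣ) hyperplane
    hyperplane-cong
    (λ {x} {y} eq → realPair-injective x y (pushforward-injective (realPair x) (realPair y) eq))
    surjective
    (⊎-size (×-size size size) size)
    where
    parameters = ⊎-setoid (×-setoid setoid setoid) setoid
    module Parameters = Setoid parameters
    member : ∀ x → ℋ₂ᵣ (pushforward (realPair x) (realPair-nonZero x))
    member x@(inj₁ (c , d)) = s≈0⇒ℋ₂ᵣ 1# c d (realPair-nonZero x) (1≉0 ∘ proj₁)
    member x@(inj₂ d)       = s≈0⇒ℋ₂ᵣ 0# 1# d (realPair-nonZero x) (1≉0 ∘ proj₂)
    through : ∀ x → pushforward (realPair x) (realPair-nonZero x) ⊇ L
    through x@(inj₁ (c , d)) = normal⇒⊇ 0# 1# c d (realPair-nonZero x)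
    through x@(inj₂ d)       = normal⇒⊇ 0# 0# 1# d (realPair-nonZero x)
    hyperplane : (Carrier × Carrier) ⊎ Carrier → Setoid.Carrier (hyperplanesThrough L ℋ₂ᵣ)
    hyperplane x = pushforward (realPair x) (realPair-nonZero x) , member x , through x
    hyperplane-cong : ∀ {x y} → x Parameters.≈ y → coords (proj₁ (hyperplane x)) ∼ coords (proj₁ (hyperplane y))
    hyperplane-cong {x} {y} (inj₁ (c≈ , d≈)) = pushforward-∼ (realPair x) (realPair y) (≈⇒∼ (normal-cong refl refl c≈ d≈))
    hyperplane-cong {x} {y} (inj₂ d≈)        = pushforward-∼ (realPair x) (realPair y) (≈⇒∼ (normal-cong refl refl refl d≈))
    realPair-injective : ∀ x y → realPair x ∼ realPair y → x Parameters.≈ y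
    realPair-injective x@(inj₁ _) y@(inj₁ _) eq = inj₁ (x≈y 4F , x≈y 5F)
      where x≈y = ∼-normalised (realPair x) (realPair y) 2F refl refl eq
    realPair-injective x@(inj₂ _) y@(inj₂ _) eq = inj₂ (∼-normalised (realPair x) (realPair y) 4F refl refl eq 5F)
    realPair-injective (inj₁ _) (inj₂ _) (k , _ , eq) = contradiction (trans (eq 2F) (zeroʳ k)) 1≉0
    realPair-injective (inj₂ _) (inj₁ _) (k , k≉0 , eq) = contradiction (trans (sym (*-identityʳ k)) (sym (eq 2F))) k≉0
    surjective : ∀ y → ∃[ x ] coords (proj₁ (hyperplane x)) ∼ coords (proj₁ y)
    surjective (H , H∈ℋ₂ᵣ , H⊇L) = proj₁ pair , pushforward-pullback (realPair (proj₁ pair)) H (proj₂ pair)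
      where
      a≈ = ℋ₂ᵣ⇒normal H H∈ℋ₂ᵣ H⊇L
      pair : ∃[ x ] realPair x ∼ pullback H
      pair = realPair-surjective (pullback H) (proj₁ a≈) (proj₂ a≈)

  centred-nonZero : ∀ α β δ → NonZero (centred α β δ)
  centred-nonZero α β δ eq = 1≉0 (eq 0F)

  centredHyperplane : (α β δ : Carrier) → Hyperplane
  centredHyperplane α β δ = pushforward (centred α β δ) (centred-nonZero α β δ)

  centred-⊇ : ∀ α β δ → centredHyperplane α β δ ⊇ L
  centred-⊇ α β δ = normal⇒⊇ 1# (α + α + u * v * β) (u * v * α - (v * β + v * β))
    (α * α + u * v * (α * β) - v * (β * β) + δ) (centred-nonZero α β δ)

  s≉0⇒centred : ∀ H → H ⊇ L → ¬ (pullback H 0F ≈ 0#) →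
                ∃[ α ] ∃[ β ] ∃[ δ ] centred α β δ ∼ pullback H
  s≉0⇒centred H H⊇L s≉0 = centred-surjective (pullback H) s≉0 (⊇⇒normal {H} H⊇L)

  disc-∼ : ∀ {a b} → a ∼ b → disc b ≈ 0# → disc a ≈ 0#
  disc-∼ {b = b} (k , _ , eq) disc≈0 = trans (disc-cong eq) (trans (disc-scale k b) (trans (*-congˡ disc≈0) (zeroʳ _)))

  disc-pullback : ∀ H → disc (pullback H) ≈ 0# → disc (coords H) ≈ 0#
  disc-pullback H eq = disc-∼ {coords H} {pullback H ⋆ C} (≈⇒∼ λ i → sym (pullback-⋆ H i)) (disc-⋆≈0 (pullback H) C eq)

  -- A conjugate pair has `s ≠ 0`, hence a centred form, and its discriminant is zero, which by
  -- `centred-disc≈0` leaves `δ = 0` and the free parameters α, β.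
  ℋ₂ᵢ-size : HasSize (hyperplanesThrough L (ℋ₂ᵢ X)) (q ℕ.* q)
  ℋ₂ᵢ-size = transfer (hyperplanesThrough L (ℋ₂ᵢ X)) hyperplane
    (λ {x} {y} (α≈ , β≈) → pushforward-∼ (form x) (form y) (≈⇒∼ (centred-cong α≈ β≈ refl)))
    (λ {x} {y} eq → proj₁ (centred-injective _ _ _ _ _ _ (pushforward-injective (form x) (form y) eq)))
    surjective
    (×-size size size)
    where
    form : Carrier × Carrier → Vector Carrier 6
    form (α , β) = centred α β 0#
    hyperplane : Carrier × Carrier → Setoid.Carrier (hyperplanesThrough L (ℋ₂ᵢ X))
    hyperplane (α , β) = centredHyperplane α β 0#
      , (1# , factor α β FE.⋆ₗ ιₘ C
        , factor-≁-conj α β ∘ conjugate-∼-⋆ₗ (factor α β) C A inverseˡ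
        , ι-⋆-norm-form (centred α β 0#) 1# (factor α β) C (ι-centred α β))
      , centred-⊇ α β 0#
    surjective : ∀ y → ∃[ x ] coords (proj₁ (hyperplane x)) ∼ coords (proj₁ y)
    surjective (H , (k , l , l≁l̄ , H≈) , H⊇L) = centre (s≉0⇒centred H H⊇L s≉0)
      where
      a = pullback H
      s≉0 : ¬ (a 0F ≈ 0#)
      s≉0 s≈0 = l≁l̄ (conjugate-∼-⋆ₗ l A C inverseʳ
        (conjugate-factors-nonvanishing a k (l FE.⋆ₗ ιₘ A) (ι-⋆-norm-form (coords H) k l A H≈)
          (pullback-nonZero H) s≈0
          (trans (normal-s≈0 {H} H⊇L s≈0 1F) (zeroʳ _))
          (trans (normal-s≈0 {H} H⊇L s≈0 3F) (trans (-‿cong (zeroʳ v)) -0#≈0#))))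
      disc≈0 : disc a ≈ 0#
      disc≈0 = disc-⋆≈0 (coords H) A (conjugate-factors-disc (coords H) k l H≈)
      centre : (∃[ α ] ∃[ β ] ∃[ δ ] centred α β δ ∼ a) → ∃[ x ] (form x ⋆ C) ∼ coords H
      centre (α , β , δ , eq) = (α , β) , pushforward-pullback (centred α β 0#) H
        (∼-trans {u = centred α β 0#} {v = centred α β δ} {w = a}
          (≈⇒∼ (centred-cong refl refl (sym (centred-disc≈0 α β δ (disc-∼ {centred α β δ} {a} eq disc≈0))))) eq)

  -- For `s = 0` the form is divisible by X₂ and therefore singular, so all nonsingular conics are
  -- centred; among those, nonsingularity is `δ ≠ 0`.
  ℋ₃-size : HasSize (hyperplanesThrough L ℋ₃) (q ℕ.* q ℕ.* (q ∸ 1))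
  ℋ₃-size = transfer (hyperplanesThrough L ℋ₃) hyperplane
    (λ {x} {y} ((α≈ , β≈) , δ≈) → pushforward-∼ (form x) (form y) (≈⇒∼ (centred-cong α≈ β≈ δ≈)))
    (λ {x} {y} eq → centred-injective _ _ _ _ _ _ (pushforward-injective (form x) (form y) eq))
    surjective
    (×-size (×-size size size) (without-size 0# size))
    where
    form : (Carrier × Carrier) × Setoid.Carrier (without setoid 0#) → Vector Carrier 6
    form ((α , β) , (δ , _)) = centred α β δ
    hyperplane : (Carrier × Carrier) × Setoid.Carrier (without setoid 0#) → Setoid.Carrier (hyperplanesThrough L ℋ₃)
    hyperplane ((α , β) , (δ , δ≉0)) = centredHyperplane α β δ
      , (λ disc≈0 → δ≉0 (centred-disc≈0 α β δ (disc-∼ {centred α β δ} {(centred α β δ ⋆ C) ⋆ A} (≈⇒∼ λ i → sym (⋆-inverse C A inverseˡ (centred α β δ) i))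
                           (disc-⋆≈0 (centred α β δ ⋆ C) A disc≈0))))
      , centred-⊇ α β δ
    surjective : ∀ y → ∃[ x ] coords (proj₁ (hyperplane x)) ∼ coords (proj₁ y)
    surjective (H , disc≉0 , H⊇L) = centre (s≉0⇒centred H H⊇L s≉0)
      where
      a = pullback H
      s≉0 : ¬ (a 0F ≈ 0#)
      s≉0 s≈0 = disc≉0 (disc-pullback H (trans
        (disc-cong λ i → trans (normal-s≈0 {H} H⊇L s≈0 i) (X₂*-normal (a 2F) (a 4F) (a 5F) i))
        (disc-product-form X₂ (a 2F ∷ a 4F ∷ a 5F ∷ []))))
      centre : (∃[ α ] ∃[ β ] ∃[ δ ] centred α β δ ∼ a) → ∃[ x ] (form x ⋆ C) ∼ coords H
      centre (α , β , δ , eq) = ((α , β) , (δ , δ≉0)) , pushforward-pullback (centred α β δ) H eq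
        where
        δ≉0 : ¬ (δ ≈ 0#)
        δ≉0 δ≈0 = disc≉0 (disc-pullback H (disc-∼ {a} {centred α β δ} (∼-sym {v = centred α β δ} {w = a} eq)
          (trans (centred-disc α β δ) (trans (-‿cong (trans (*-congˡ δ≈0) (zeroʳ Δ))) -0#≈0#))))

open import Data.Nat.Base using (_+_; _^_)

lemma4p8 :
    {c ℓ c′ ℓ′ : Level} (q : ℕ) → IsPrimePower q →
    (F : FiniteField q c ℓ) (X : QuadraticExtension F c′ ℓ′) →
    (L : Projective.Line F 5) → Projective.o₁₀ F L →
    OD₄ X L (1 , q ^ 2 + q , q ^ 2 , q ^ 3 ∸ q ^ 2)
lemma4p8 q _ F X L (u , v₀ , v₀≉0 , no-root , A , L≐) =
    ℋ₁-size
  , ≡.subst (HasSize _) (≡.cong (_+ q) q*q≡q²) ℋ₂ᵣ-size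
  , ≡.subst (HasSize _) q*q≡q² ℋ₂ᵢ-size
  , ≡.subst (HasSize _) q*q*[q∸1]≡q³∸q² ℋ₃-size
  where
  irreducible = FiniteFieldProperties.reversed-irreducible F v₀≉0 no-root
  roots = QuadraticExtensionProperties.conjugateRoots X (FiniteField._*_ F u v₀) v₀ irreducible
  open HyperplanesThroughLine X L u v₀ v₀≉0 irreducible roots A L≐
  q*q≡q² : q ℕ.* q ≡ q ^ 2
  q*q≡q² = ≡.cong (q ℕ.*_) (≡.sym (ℕₚ.*-identityʳ q))
  q*q*[q∸1]≡q³∸q² : q ℕ.* q ℕ.* (q ∸ 1) ≡ q ^ 3 ∸ q ^ 2
  q*q*[q∸1]≡q³∸q² = ≡.trans (ℕₚ.*-distribˡ-∸ (q ℕ.* q) q 1) (≡.cong₂ _∸_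
    (≡.trans (ℕₚ.*-comm (q ℕ.* q) q) (≡.cong (q ℕ.*_) q*q≡q²))
    (≡.trans (ℕₚ.*-identityʳ (q ℕ.* q)) q*q≡q²))
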